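{- Let $\mathcal{C}$ be the set of integer partitions satisfying all of the following: (i) no two consecutive integers both appear as parts; (ii) odd parts do not repeat; (iii) each even part appears at most twice; (iv) if an even part $2j$ appears twice, then none of $2j-3,\,2j-2,\,2j+2,\,2j+3$ appears as a part. Let - $\mathcal{P}_1$ be the set of $\pi\in\mathcal{C}$ in which $2+2$ does not occur as a sub-partition (i.e. $2$ appears at most once), - $\mathcal{P}_2$ be the set of $\pi\in\mathcal{C}$ in which $1$ does not appear as a part, - $\mathcal{P}_3$ be the set of $\pi\in\mathcal{C}$ in which none of $1,2,3$ appears as a part. Then, as formal power series in $x,q$, writing $N=i+2j+3k$, $$\sum_{\pi\in\mathcal{P}_1}x^{\ell(\pi)}q^{|\pi|}=\sum_{i,j,k\ge 0}(-1)^k\frac{x^{N}q^{N(N-1)+i+6j+3k^2+6k}}{(q;q)_i\,(q^4;q^4)_j\,(q^6;q^6)_k},$$ $$\sum_{\pi\in\mathcal{P}_2}x^{\ell(\pi)}q^{|\pi|}=\sum_{i,j,k\ge 0}(-1)^k\frac{x^{N}q^{N(N-1)+2i+2j+3k^2+6k}}{(q;q)_i\,(q^4;q^4)_j\,(q^6;q^6)_k},$$ $$\sum_{\pi\in\mathcal{P}_3}x^{\ell(\pi)}q^{|\pi|}=\sum_{i,j,k\ge 0}(-1)^k\frac{x^{N}q^{N(N-1)+4i+6j+3k^2+12k}}{(q;q)_i\,(q^4;q^4)_j\,(q^6;q^6)_k}.$$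
   Context: Partitions are finite weakly increasing sequences of positive integers (the empty partition is included); $\ell(\pi)$ is the number of parts and $|\pi|$ the sum of the parts of $\pi$. A sub-partition of a partition is a contiguous portion of it. For $n\ge 0$, $(a;q)_n=\prod_{0\le t<n}(1-aq^t)$. All identities are identities of formal power series. -}

module Defs where

open import Data.Nat.Base as ℕ using (ℕ; zero; suc; _∸_; _≤_; _<_)
import Data.Nat.Properties as ℕ
open import Data.Integer.Base as ℤ using (ℤ; 0ℤ; 1ℤ; -1ℤ)
import Data.Integer.Properties as ℤ
open import Data.Bool.Base using (if_then_else_)
open import Data.Fin.Base using (Fin; zero; suc; toℕ)
open import Data.List.Base using (List; []; _∷_; map; foldr; filter; length)
open import Data.Nat.ListAction using (sum)
open import Data.List.Membership.Propositional using (_∈_; _∉_)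
open import Data.List.Relation.Unary.All using (All)
open import Data.List.Relation.Unary.Linked using (Linked)
open import Data.List.Relation.Unary.Unique.Propositional using (Unique)
open import Data.List.Relation.Binary.Infix.Heterogeneous using (Infix)
open import Data.Product.Base using (_×_; _,_; ∃-syntax)
open import Data.Vec.Base using (Vec; []; _∷_; head; lookup)
open import Relation.Nullary using (¬_)
open import Relation.Nullary.Decidable using (⌊_⌋)
open import Relation.Binary.PropositionalEquality
open import Algebra.Properties.Monoid.Sum ℤ.+-0-monoid
  using (sum-cong-≗; sum-syntax; sum⁺-syntax)

------------------------------------------------------------------------
-- Partitions

Partition : List ℕ → Set
Partition π = All (0 <_) π × Linked _≤_ π

ℓ : List ℕ → ℕ
ℓ = length

mult : ℕ → List ℕ → ℕ
mult a π = length (filter (ℕ._≟ a) π)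

-- Truncated subtraction is harmless in the last condition: where it differs
-- from subtraction in ℤ it yields 0, and neither 0 nor a negative number is
-- ever a part.
record 𝒞 (π : List ℕ) : Set where
  field
    partition      : Partition π
    noConsecutive  : ∀ a → ¬ (a ∈ π × suc a ∈ π)
    oddDistinct    : ∀ j → mult (2 ℕ.* j ℕ.+ 1) π ≤ 1
    evenAtMost2    : ∀ j → mult (2 ℕ.* j) π ≤ 2
    repeatedEven   : ∀ j → mult (2 ℕ.* j) π ≡ 2 →
                     2 ℕ.* j ∸ 3 ∉ π × 2 ℕ.* j ∸ 2 ∉ π ×
                     2 ℕ.* j ℕ.+ 2 ∉ π × 2 ℕ.* j ℕ.+ 3 ∉ π

𝒫₁ 𝒫₂ 𝒫₃ : List ℕ → Set
𝒫₁ π = 𝒞 π × ¬ Infix _≡_ (2 ∷ 2 ∷ []) π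
𝒫₂ π = 𝒞 π × 1 ∉ π
𝒫₃ π = 𝒞 π × 1 ∉ π × 2 ∉ π × 3 ∉ π

------------------------------------------------------------------------
-- The ring ℤ[[q]]; a series is its coefficient function

ℤ⟦q⟧ : Set
ℤ⟦q⟧ = ℕ → ℤ

q^ : ℕ → ℤ⟦q⟧
q^ e n = if ⌊ n ℕ.≟ e ⌋ then 1ℤ else 0ℤ

𝟙 : ℤ⟦q⟧
𝟙 = q^ 0

infixl 6 _⊖_
infixl 7 _⊛_ _•_
infixr 8 _⋆_

_⊖_ : ℤ⟦q⟧ → ℤ⟦q⟧ → ℤ⟦q⟧
(f ⊖ g) n = f n ℤ.- g n

_•_ : ℤ → ℤ⟦q⟧ → ℤ⟦q⟧
(c • f) n = c ℤ.* f n

_⊛_ : ℤ⟦q⟧ → ℤ⟦q⟧ → ℤ⟦q⟧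
(f ⊛ g) n = ∑[ i ≤ n ] (f (toℕ i) ℤ.* g (n ∸ toℕ i))

_⋆_ : ℤ⟦q⟧ → ℕ → ℤ⟦q⟧
f ⋆ zero  = 𝟙
f ⋆ suc t = f ⊛ f ⋆ t

pochhammer : ℤ⟦q⟧ → ℤ⟦q⟧ → ℕ → ℤ⟦q⟧
pochhammer a b zero    = 𝟙
pochhammer a b (suc n) = pochhammer a b n ⊛ (𝟙 ⊖ a ⊛ b ⋆ n)

-- The coefficients bₙ , … , b₀ of the inverse of a series f with f 0 ≡ 1,
-- from b₀ = 1 and bₙ₊₁ = - ∑_{i ≤ n} fᵢ₊₁ bₙ₋ᵢ.
inverseCoeffs : ℤ⟦q⟧ → ∀ n → Vec ℤ (suc n)
inverseCoeffs f zero    = 1ℤ ∷ []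
inverseCoeffs f (suc n) =
  ℤ.- (∑[ i ≤ n ] (f (suc (toℕ i)) ℤ.* lookup (inverseCoeffs f n) i))
  ∷ inverseCoeffs f n

-- Meaningful only for constant term 1; see inverseʳ.
1/_ : ℤ⟦q⟧ → ℤ⟦q⟧
(1/ f) n = head (inverseCoeffs f n)

lookup-inverseCoeffs : ∀ f n (i : Fin (suc n)) →
                       lookup (inverseCoeffs f n) i ≡ (1/ f) (n ∸ toℕ i)
lookup-inverseCoeffs f zero    zero    = refl
lookup-inverseCoeffs f (suc n) zero    = refl
lookup-inverseCoeffs f (suc n) (suc i) = lookup-inverseCoeffs f n i

inverseʳ : ∀ f → f 0 ≡ 1ℤ → f ⊛ (1/ f) ≗ 𝟙
inverseʳ f f₀≡1 zero    rewrite f₀≡1 = refl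
inverseʳ f f₀≡1 (suc n) = begin
  f 0 ℤ.* (ℤ.- s) ℤ.+ ∑[ i ≤ n ] (f (suc (toℕ i)) ℤ.* (1/ f) (n ∸ toℕ i))
    ≡⟨ cong₂ (λ c t → c ℤ.* (ℤ.- s) ℤ.+ t) f₀≡1
         (sum-cong-≗ (λ i → cong (f (suc (toℕ i)) ℤ.*_) (sym (lookup-inverseCoeffs f n i)))) ⟩
  1ℤ ℤ.* (ℤ.- s) ℤ.+ s
    ≡⟨ cong (ℤ._+ s) (ℤ.*-identityˡ (ℤ.- s)) ⟩
  ℤ.- s ℤ.+ s
    ≡⟨ ℤ.+-inverseˡ s ⟩
  0ℤ ∎
  where
  open ≡-Reasoning
  s = ∑[ i ≤ n ] (f (suc (toℕ i)) ℤ.* lookup (inverseCoeffs f n) i)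

⊛-constant : ∀ f g → (f ⊛ g) 0 ≡ f 0 ℤ.* g 0
⊛-constant f g = ℤ.+-identityʳ (f 0 ℤ.* g 0)

pochhammer-constant : ∀ a b → a 0 ≡ 0ℤ → ∀ n → pochhammer a b n 0 ≡ 1ℤ
pochhammer-constant a b a₀≡0 zero = refl
pochhammer-constant a b a₀≡0 (suc n)
  rewrite ⊛-constant (pochhammer a b n) (𝟙 ⊖ a ⊛ b ⋆ n)
        | pochhammer-constant a b a₀≡0 n
        | ⊛-constant a (b ⋆ n)
        | a₀≡0
        = refl

------------------------------------------------------------------------
-- ℤ[[x,q]]: S m n is the coefficient of xᵐqⁿ

ℤ⟦x,q⟧ : Set
ℤ⟦x,q⟧ = ℕ → ℕ → ℤ

infix 5 x^_·_

x^_·_ : ℕ → ℤ⟦q⟧ → ℤ⟦x,q⟧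
(x^ e · f) m n = if ⌊ m ℕ.≟ e ⌋ then f n else 0ℤ

-- S is the formal sum of the series F i over all i satisfying P: for each
-- monomial only finitely many F i contribute, and S collects them.
HasSum : {I : Set} → (I → Set) → (I → ℤ⟦x,q⟧) → ℤ⟦x,q⟧ → Set
HasSum {I} P F S = ∀ m n → ∃[ is ]
  (Unique is × All P is × (∀ i → P i → i ∉ is → F i m n ≡ 0ℤ) ×
  S m n ≡ foldr ℤ._+_ 0ℤ (map (λ i → F i m n) is))

-- Both formal sums exist and they are equal.
SameSum : {I J : Set} → (I → Set) → (I → ℤ⟦x,q⟧) →
          (J → Set) → (J → ℤ⟦x,q⟧) → Set
SameSum P F Q G = ∃[ S ] (HasSum P F S × HasSum Q G S)

weight : List ℕ → ℤ⟦x,q⟧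
weight π = x^ ℓ π · q^ (sum π)

-- The (i , j , k) term, where e i j k is the exponent of q beyond N(N-1).
-- (Truncation in N ∸ 1 does not matter, as N(N-1) = 0 for N = 0.)
summand : (ℕ → ℕ → ℕ → ℕ) → ℕ × ℕ × ℕ → ℤ⟦x,q⟧
summand e (i , j , k) =
  x^ N · (-1ℤ ℤ.^ k) • (q^ (N ℕ.* (N ∸ 1) ℕ.+ e i j k) ⊛
    (1/ (pochhammer (q^ 1) (q^ 1) i ⊛ pochhammer (q^ 4) (q^ 4) j ⊛ pochhammer (q^ 6) (q^ 6) k)))
  where N = i ℕ.+ 2 ℕ.* j ℕ.+ 3 ℕ.* k

{-# OPTIONS --safe #-}

-- Let S a b c be the triple series with exponent N(N-1) + ai + bj + 3k² + ck.
-- Cancelling a factor 1 - qⁱ, 1 - q⁴ʲ or 1 - q⁶ᵏ of the denominator relates S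
-- to itself with shifted parameters (S-i, S-j, S-k).  On the other side, let
-- P, Q, R be the generating functions of 𝒫₁, of 𝒫₂, and of the members of 𝒫₁
-- without the part 1.  Splitting off the smallest parts gives
--   P(x) = xq P(xq²) + R(x),
--   Q(x) = x²q⁴ Q(xq⁴) + R(x),
--   R(x) = xq² R(xq²) + P(xq²) + x²q⁸ Q(xq⁶),
-- and 𝒫₃ has the generating function Q(xq²).  For P = S 1 6 6, Q = S 2 2 6,
-- R = S 2 6 6 the first two equations are contiguity relations, and the third
-- reduces to the vanishing of
--   E(x) = S 7 14 18 - S 8 14 24 - xq⁷ S 9 22 30,
-- which holds because contiguity gives E(x) = x³q²⁷ E(xq⁶).

module Submission where

open import Defs
open import Data.Nat.Base as ℕ using (ℕ; zero; suc; _+_; _*_; _^_; _∸_; z≤n; s≤s)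
import Data.Nat.Properties as ℕ
import Data.Nat.Tactic.RingSolver as ℕ-Solver
open import Data.Nat.ListAction using (sum)
open import Data.Integer.Base as ℤ using (ℤ; 0ℤ; 1ℤ; -1ℤ)
import Data.Integer.Properties as ℤ
open import Data.Integer.Tactic.RingSolver using (solve-∀)
open import Data.Bool.Base using (true; false; if_then_else_)
open import Data.Empty using (⊥; ⊥-elim)
open import Data.Fin.Base using (toℕ)
open import Data.List.Base
  using (List; []; _∷_; _++_; map; foldr; length; applyUpTo; upTo; cartesianProduct)
import Data.List.Properties as List
open import Data.List.Membership.Propositional using (_∈_; _∉_)
open import Data.List.Membership.Propositional.Properties
  using (∈-map⁺; ∈-++⁺ˡ; ∈-++⁺ʳ; ∈-cartesianProduct⁺; ∈-upTo⁺)
open import Data.List.Relation.Binary.Disjoint.Propositional using (Disjoint)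
open import Data.List.Relation.Binary.Infix.Heterogeneous using (Infix; here; there)
open import Data.List.Relation.Binary.Prefix.Heterogeneous using ([]; _∷_)
open import Data.List.Relation.Unary.All as All using (All; []; _∷_)
import Data.List.Relation.Unary.All.Properties as All
import Data.List.Relation.Unary.AllPairs as AllPairs
open import Data.List.Relation.Unary.Any using (here; there)
open import Data.List.Relation.Unary.Linked as Linked using (Linked; []; [-]; _∷_)
open import Data.List.Relation.Unary.Linked.Properties using (Linked⇒All)
open import Data.List.Relation.Unary.Unique.Propositional using (Unique)
import Data.List.Relation.Unary.Unique.Propositional.Properties as Unique
open import Data.Product.Base using (_×_; _,_; proj₁; proj₂; ∃-syntax)
open import Data.Sum.Base using (_⊎_; inj₁; inj₂)
open import Data.Unit.Base using (tt)
open import Function.Base using (_∘_)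
open import Relation.Binary.PropositionalEquality
open import Relation.Nullary using (yes; no; ¬_)
open import Relation.Nullary.Decidable using (⌊_⌋; isYes≗does)
open import Relation.Unary using (U)
open import Algebra.Properties.Monoid.Sum ℤ.+-0-monoid using (sum-cong-≗)
import Relation.Binary.Reasoning.Setoid as SetoidReasoning

-- The third equation contains P(xq²) with no factor x, so induction on the power of x cannot show
-- that the equations determine P, Q and R. What grows with every use of an equation is the lower
-- bound s on the parts. Hence everything is stated for the classes with all parts raised by s, and
-- the induction runs on a number n for the coefficients below q^(n+s): n drops by 1 while s rises
-- by at least 2. Only even s are admissible, since the conditions depend on the parity of the
-- parts. On the series side, putting xq^s for x multiplies a term by q^(sN), and N = i+2j+3k turns
-- this into adding s, 2s, 3s to the three parameters. The series E measures a mismatch. Two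
-- contiguity steps from R leave x²q⁸ S 7 14 18 where the third equation has x²q⁸ S 8 14 24, and
-- raising the third parameter of S 3 10 6 from 6 to 12 costs x³q¹⁵ S 9 22 30. The difference is
-- x²q⁸ E. The equation E(x) = x³q²⁷ E(xq⁶) makes E divisible by every power of x; here induction on
-- the power of x does suffice.

private
  module ≗-Reasoning = SetoidReasoning (ℕ →-setoid ℤ)

  variable
    f f′ g g′ : ℤ⟦q⟧
    V W : ℤ⟦x,q⟧

-- The ring ℤ⟦q⟧

-- (f ⊛ g) (suc n) reduces to f 0 * g (suc n) + (tail f ⊛ g) n, which drives
-- the inductions below.
tail : ℤ⟦q⟧ → ℤ⟦q⟧
tail f n = f (suc n)

⊛-cong : f ≗ f′ → g ≗ g′ → f ⊛ g ≗ f′ ⊛ g′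
⊛-cong p r n = sum-cong-≗ {suc n} (λ i → cong₂ ℤ._*_ (p (toℕ i)) (r (n ∸ toℕ i)))

⊛-congˡ : ∀ f → g ≗ g′ → f ⊛ g ≗ f ⊛ g′
⊛-congˡ f = ⊛-cong {f = f} (λ _ → refl)

⊛-congʳ : ∀ g → f ≗ f′ → f ⊛ g ≗ f′ ⊛ g
⊛-congʳ g p = ⊛-cong {g = g} p (λ _ → refl)

-- Scaling and addition are treated together because `tail (f ⊛ g)` unfolds to `f 0` times `tail g`
-- plus `tail f ⊛ g`, the combination met in associativity. With `c` equal to -1 it serves for
-- subtraction.
⊛-linearˡ : ∀ c f g h → (λ m → c ℤ.* f m ℤ.+ g m) ⊛ h ≗ λ n → c ℤ.* (f ⊛ h) n ℤ.+ (g ⊛ h) n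
⊛-linearˡ c f g h zero    = rearrange c (f 0) (g 0) (h 0)
  where
  rearrange : ∀ c x y z → (c ℤ.* x ℤ.+ y) ℤ.* z ℤ.+ 0ℤ
            ≡ c ℤ.* (x ℤ.* z ℤ.+ 0ℤ) ℤ.+ (y ℤ.* z ℤ.+ 0ℤ)
  rearrange = solve-∀
⊛-linearˡ c f g h (suc n) = trans
  (cong (ℤ._+_ ((c ℤ.* f 0 ℤ.+ g 0) ℤ.* h (suc n))) (⊛-linearˡ c (tail f) (tail g) h n))
  (rearrange c (f 0) (g 0) (h (suc n)) ((tail f ⊛ h) n) ((tail g ⊛ h) n))
  where
  rearrange : ∀ c x y z s t → (c ℤ.* x ℤ.+ y) ℤ.* z ℤ.+ (c ℤ.* s ℤ.+ t)
            ≡ c ℤ.* (x ℤ.* z ℤ.+ s) ℤ.+ (y ℤ.* z ℤ.+ t)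
  rearrange = solve-∀

-- The mirror image of the unfolding of `⊛`, which splits off the constant term of the first factor.
-- Commutativity compares the two.
⊛-suc : ∀ f g n → (f ⊛ g) (suc n) ≡ g 0 ℤ.* f (suc n) ℤ.+ (f ⊛ tail g) n
⊛-suc f g zero    = rearrange (f 0) (f 1) (g 0) (g 1)
  where
  rearrange : ∀ x x′ y y′ → x ℤ.* y′ ℤ.+ (x′ ℤ.* y ℤ.+ 0ℤ) ≡ y ℤ.* x′ ℤ.+ (x ℤ.* y′ ℤ.+ 0ℤ)
  rearrange = solve-∀
⊛-suc f g (suc n) = trans
  (cong (ℤ._+_ (f 0 ℤ.* g (2 + n))) (⊛-suc (tail f) g n))
  (rearrange (f 0 ℤ.* g (2 + n)) (g 0 ℤ.* f (2 + n)) ((tail f ⊛ tail g) n))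
  where
  rearrange : ∀ x y z → x ℤ.+ (y ℤ.+ z) ≡ y ℤ.+ (x ℤ.+ z)
  rearrange = solve-∀

⊛-comm : ∀ f g → f ⊛ g ≗ g ⊛ f
⊛-comm f g zero    = cong (ℤ._+ 0ℤ) (ℤ.*-comm (f 0) (g 0))
⊛-comm f g (suc n) = trans (cong (ℤ._+_ (f 0 ℤ.* g (suc n))) (⊛-comm (tail f) g n))
                           (sym (⊛-suc g f n))

⊛-assoc : ∀ f g h → (f ⊛ g) ⊛ h ≗ f ⊛ (g ⊛ h)
⊛-assoc f g h zero    = rearrange (f 0) (g 0) (h 0)
  where
  rearrange : ∀ x y z → (x ℤ.* y ℤ.+ 0ℤ) ℤ.* z ℤ.+ 0ℤ ≡ x ℤ.* (y ℤ.* z ℤ.+ 0ℤ) ℤ.+ 0ℤ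
  rearrange = solve-∀
⊛-assoc f g h (suc n) = begin
  (f ⊛ g) 0 ℤ.* h (suc n) ℤ.+ (tail (f ⊛ g) ⊛ h) n
    ≡⟨ cong₂ ℤ._+_ (cong (ℤ._* h (suc n)) (⊛-constant f g))
                   (⊛-linearˡ (f 0) (tail g) (tail f ⊛ g) h n) ⟩
  f 0 ℤ.* g 0 ℤ.* h (suc n) ℤ.+ (f 0 ℤ.* (tail g ⊛ h) n ℤ.+ ((tail f ⊛ g) ⊛ h) n)
    ≡⟨ rearrange (f 0) (g 0) (h (suc n)) ((tail g ⊛ h) n) (((tail f ⊛ g) ⊛ h) n) ⟩
  f 0 ℤ.* (g ⊛ h) (suc n) ℤ.+ ((tail f ⊛ g) ⊛ h) n
    ≡⟨ cong (ℤ._+_ (f 0 ℤ.* (g ⊛ h) (suc n))) (⊛-assoc (tail f) g h n) ⟩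
  f 0 ℤ.* (g ⊛ h) (suc n) ℤ.+ (tail f ⊛ (g ⊛ h)) n ∎
  where
  open ≡-Reasoning
  rearrange : ∀ x y z s t → x ℤ.* y ℤ.* z ℤ.+ (x ℤ.* s ℤ.+ t) ≡ x ℤ.* (y ℤ.* z ℤ.+ s) ℤ.+ t
  rearrange = solve-∀

⊛-zeroˡ : ∀ f g → (∀ n → f n ≡ 0ℤ) → ∀ n → (f ⊛ g) n ≡ 0ℤ
⊛-zeroˡ f g f≡0 zero    = trans (⊛-constant f g) (cong (ℤ._* g 0) (f≡0 0))
⊛-zeroˡ f g f≡0 (suc n) =
  cong₂ ℤ._+_ (cong (ℤ._* g (suc n)) (f≡0 0)) (⊛-zeroˡ (tail f) g (λ m → f≡0 (suc m)) n)

⊛-identityˡ : ∀ f → 𝟙 ⊛ f ≗ f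
⊛-identityˡ f zero    = trans (⊛-constant 𝟙 f) (ℤ.*-identityˡ (f 0))
⊛-identityˡ f (suc n) = trans
  (cong₂ ℤ._+_ (ℤ.*-identityˡ (f (suc n))) (⊛-zeroˡ (tail 𝟙) f (λ _ → refl) n))
  (ℤ.+-identityʳ (f (suc n)))

⊛-identityʳ : ∀ f → f ⊛ 𝟙 ≗ f
⊛-identityʳ f n = trans (⊛-comm f 𝟙 n) (⊛-identityˡ f n)

⊛-swap : ∀ f g h → f ⊛ g ⊛ h ≗ f ⊛ h ⊛ g
⊛-swap f g h = begin
  f ⊛ g ⊛ h   ≈⟨ ⊛-assoc f g h ⟩
  f ⊛ (g ⊛ h) ≈⟨ ⊛-congˡ f (⊛-comm g h) ⟩
  f ⊛ (h ⊛ g) ≈⟨ ⊛-assoc f h g ⟨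
  f ⊛ h ⊛ g   ∎
  where open ≗-Reasoning

1-⊖-⊛ : ∀ f g → (𝟙 ⊖ f) ⊛ g ≗ g ⊖ f ⊛ g
1-⊖-⊛ f g n = begin
  ((𝟙 ⊖ f) ⊛ g) n
    ≡⟨ ⊛-congʳ g (λ m → rearrange (𝟙 m) (f m)) n ⟩
  ((λ m → -1ℤ ℤ.* f m ℤ.+ 𝟙 m) ⊛ g) n
    ≡⟨ ⊛-linearˡ -1ℤ f 𝟙 g n ⟩
  -1ℤ ℤ.* (f ⊛ g) n ℤ.+ (𝟙 ⊛ g) n
    ≡⟨ rearrange ((𝟙 ⊛ g) n) ((f ⊛ g) n) ⟨
  (𝟙 ⊛ g) n ℤ.- (f ⊛ g) n
    ≡⟨ cong (ℤ._- (f ⊛ g) n) (⊛-identityˡ g n) ⟩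
  (g ⊖ f ⊛ g) n ∎
  where
  open ≡-Reasoning
  rearrange : ∀ x y → x ℤ.- y ≡ -1ℤ ℤ.* y ℤ.+ x
  rearrange = solve-∀

-- Insert f · 1/f = 1 after 1/g, write f = g h and cancel g.
1/-⊛ : ∀ f g h → f 0 ≡ 1ℤ → g 0 ≡ 1ℤ → f ≗ g ⊛ h → 1/ g ≗ h ⊛ 1/ f
1/-⊛ f g h f₀≡1 g₀≡1 f≗gh = begin
  1/ g                   ≈⟨ ⊛-identityʳ (1/ g) ⟨
  1/ g ⊛ 𝟙               ≈⟨ ⊛-congˡ (1/ g) (inverseʳ f f₀≡1) ⟨
  1/ g ⊛ (f ⊛ 1/ f)      ≈⟨ ⊛-congˡ (1/ g) (⊛-congʳ (1/ f) f≗gh) ⟩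
  1/ g ⊛ (g ⊛ h ⊛ 1/ f)  ≈⟨ ⊛-congˡ (1/ g) (⊛-assoc g h (1/ f)) ⟩
  1/ g ⊛ (g ⊛ (h ⊛ 1/ f)) ≈⟨ ⊛-assoc (1/ g) g (h ⊛ 1/ f) ⟨
  1/ g ⊛ g ⊛ (h ⊛ 1/ f)  ≈⟨ ⊛-congʳ (h ⊛ 1/ f) (⊛-comm (1/ g) g) ⟩
  g ⊛ 1/ g ⊛ (h ⊛ 1/ f)  ≈⟨ ⊛-congʳ (h ⊛ 1/ f) (inverseʳ g g₀≡1) ⟩
  𝟙 ⊛ (h ⊛ 1/ f)         ≈⟨ ⊛-identityˡ (h ⊛ 1/ f) ⟩
  h ⊛ 1/ f               ∎
  where open ≗-Reasoning

-- Only the `does` components of the two decisions agree by computation, so the proof passes through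
-- them.
⌊suc≟suc⌋ : ∀ m n → ⌊ suc m ℕ.≟ suc n ⌋ ≡ ⌊ m ℕ.≟ n ⌋
⌊suc≟suc⌋ m n = trans (isYes≗does (suc m ℕ.≟ suc n)) (sym (isYes≗does (m ℕ.≟ n)))

q^-suc : ∀ e → tail (q^ (suc e)) ≗ q^ e
q^-suc e n = cong (if_then 1ℤ else 0ℤ) (⌊suc≟suc⌋ n e)

q^-suc-⊛ : ∀ e f n → (q^ (suc e) ⊛ f) (suc n) ≡ (q^ e ⊛ f) n
q^-suc-⊛ e f n = trans
  (cong₂ ℤ._+_ (ℤ.*-zeroˡ (f (suc n))) (⊛-congʳ f (q^-suc e) n))
  (ℤ.+-identityˡ _)

q^-⊛ : ∀ a b → q^ a ⊛ q^ b ≗ q^ (a + b)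
q^-⊛ zero    b = ⊛-identityˡ (q^ b)
q^-⊛ (suc a) b zero    = refl
q^-⊛ (suc a) b (suc n) = trans (q^-suc-⊛ a (q^ b) n) (trans (q^-⊛ a b n) (sym (q^-suc (a + b) n)))

q^-⋆ : ∀ r n → q^ r ⋆ n ≗ q^ (n * r)
q^-⋆ r zero    _ = refl
q^-⋆ r (suc n) = begin
  q^ r ⊛ q^ r ⋆ n     ≈⟨ ⊛-congˡ (q^ r) (q^-⋆ r n) ⟩
  q^ r ⊛ q^ (n * r)   ≈⟨ q^-⊛ r (n * r) ⟩
  q^ (suc n * r)      ∎
  where open ≗-Reasoning

⊛-q^-vanishes : ∀ e f n → n ℕ.< e → (q^ e ⊛ f) n ≡ 0ℤ
⊛-q^-vanishes (suc e) f zero    _         = refl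
⊛-q^-vanishes (suc e) f (suc n) (s≤s n<e) =
  trans (q^-suc-⊛ e f n) (⊛-q^-vanishes e f n n<e)

-- Denominators and their reciprocals

-- This is 1 - q^(r(n+1)), the last factor of `pochhammer (q^ r) (q^ r) (suc n)`, in the form in
-- which it appears there on unfolding.
factor : ℕ → ℕ → ℤ⟦q⟧
factor r n = 𝟙 ⊖ q^ r ⊛ q^ r ⋆ n

factor-⊛ : ∀ r n f → factor r n ⊛ f ≗ f ⊖ q^ (suc n * r) ⊛ f
factor-⊛ r n f m = trans (1-⊖-⊛ (q^ r ⊛ q^ r ⋆ n) f m)
  (cong (λ z → f m ℤ.- z) (⊛-congʳ f (q^-⋆ r (suc n)) m))

denominator : ℕ → ℕ → ℕ → ℤ⟦q⟧
denominator i j k =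
  pochhammer (q^ 1) (q^ 1) i ⊛ pochhammer (q^ 4) (q^ 4) j ⊛ pochhammer (q^ 6) (q^ 6) k

⊛-constant-1 : f 0 ≡ 1ℤ → g 0 ≡ 1ℤ → (f ⊛ g) 0 ≡ 1ℤ
⊛-constant-1 {f} {g} p r = trans (⊛-constant f g) (cong₂ ℤ._*_ p r)

denominator-constant : ∀ i j k → denominator i j k 0 ≡ 1ℤ
denominator-constant i j k =
  ⊛-constant-1 {pochhammer (q^ 1) (q^ 1) i ⊛ pochhammer (q^ 4) (q^ 4) j}
               {pochhammer (q^ 6) (q^ 6) k}
    (⊛-constant-1 {pochhammer (q^ 1) (q^ 1) i} {pochhammer (q^ 4) (q^ 4) j}
      (pochhammer-constant (q^ 1) (q^ 1) refl i)
      (pochhammer-constant (q^ 4) (q^ 4) refl j))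
    (pochhammer-constant (q^ 6) (q^ 6) refl k)

1/denominator-i : ∀ i j k →
  1/ denominator i j k ≗ factor 1 i ⊛ 1/ denominator (suc i) j k
1/denominator-i i j k = 1/-⊛ (denominator (suc i) j k) (denominator i j k) t
  (denominator-constant (suc i) j k) (denominator-constant i j k)
  (begin
    p ⊛ t ⊛ r ⊛ s  ≈⟨ ⊛-congʳ s (⊛-swap p t r) ⟩
    p ⊛ r ⊛ t ⊛ s  ≈⟨ ⊛-swap (p ⊛ r) t s ⟩
    p ⊛ r ⊛ s ⊛ t  ∎)
  where
  open ≗-Reasoning
  p = pochhammer (q^ 1) (q^ 1) i
  r = pochhammer (q^ 4) (q^ 4) j
  s = pochhammer (q^ 6) (q^ 6) k
  t = factor 1 i

1/denominator-j : ∀ i j k →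
  1/ denominator i j k ≗ factor 4 j ⊛ 1/ denominator i (suc j) k
1/denominator-j i j k = 1/-⊛ (denominator i (suc j) k) (denominator i j k) t
  (denominator-constant i (suc j) k) (denominator-constant i j k)
  (begin
    p ⊛ (r ⊛ t) ⊛ s  ≈⟨ ⊛-congʳ s (⊛-assoc p r t) ⟨
    p ⊛ r ⊛ t ⊛ s    ≈⟨ ⊛-swap (p ⊛ r) t s ⟩
    p ⊛ r ⊛ s ⊛ t    ∎)
  where
  open ≗-Reasoning
  p = pochhammer (q^ 1) (q^ 1) i
  r = pochhammer (q^ 4) (q^ 4) j
  s = pochhammer (q^ 6) (q^ 6) k
  t = factor 4 j

1/denominator-k : ∀ i j k →
  1/ denominator i j k ≗ factor 6 k ⊛ 1/ denominator i j (suc k)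
1/denominator-k i j k = 1/-⊛ (denominator i j (suc k)) (denominator i j k) (factor 6 k)
  (denominator-constant i j (suc k)) (denominator-constant i j k)
  (λ n → sym (⊛-assoc (pochhammer (q^ 1) (q^ 1) i ⊛ pochhammer (q^ 4) (q^ 4) j)
                      (pochhammer (q^ 6) (q^ 6) k) (factor 6 k) n))

1/denominator-0 : 1/ denominator 0 0 0 ≗ 𝟙
1/denominator-0 = begin
  1/ d      ≈⟨ ⊛-identityˡ (1/ d) ⟨
  𝟙 ⊛ 1/ d  ≈⟨ ⊛-congʳ (1/ d) (λ n → trans (⊛-identityʳ (𝟙 ⊛ 𝟙) n) (⊛-identityʳ 𝟙 n)) ⟨
  d ⊛ 1/ d  ≈⟨ inverseʳ d refl ⟩
  𝟙         ∎
  where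
  open ≗-Reasoning
  d = denominator 0 0 0

-- Multiplication by monomials

-- shift r a V is xʳ qᵃ V.
shift : ℕ → ℕ → ℤ⟦x,q⟧ → ℤ⟦x,q⟧
shift zero    zero    V m       n       = V m n
shift (suc r) a       V zero    n       = 0ℤ
shift (suc r) a       V (suc m) n       = shift r a V m n
shift zero    (suc a) V m       zero    = 0ℤ
shift zero    (suc a) V m       (suc n) = shift zero a V m n

-- The case distinction is uniform in `V`, so one inspection settles a statement about several
-- series under the same shift.
data ShiftView (r a m n : ℕ) : Set where
  outside : (∀ V → shift r a V m n ≡ 0ℤ) → ShiftView r a m n
  inside  : ∀ m′ n′ → m ≡ r + m′ → n ≡ a + n′ →
            (∀ V → shift r a V m n ≡ V m′ n′) → ShiftView r a m n

shiftView : ∀ r a m n → ShiftView r a m n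
shiftView zero    zero    m       n       = inside m n refl refl (λ _ → refl)
shiftView (suc r) a       zero    n       = outside (λ _ → refl)
shiftView (suc r) a       (suc m) n with shiftView r a m n
... | outside z            = outside z
... | inside m′ n′ p s z = inside m′ n′ (cong suc p) s z
shiftView zero    (suc a) m       zero    = outside (λ _ → refl)
shiftView zero    (suc a) m       (suc n) with shiftView zero a m n
... | outside z            = outside z
... | inside m′ n′ p s z = inside m′ n′ p (cong suc s) z

-- Agreement is required only at the coefficients that the shift reaches. The equations for `m` and
-- `n` supply the bounds needed in inductions on the power of x or of q.
shift-cong : ∀ r a m n →
             (∀ m′ n′ → m ≡ r + m′ → n ≡ a + n′ → V m′ n′ ≡ W m′ n′) →
             shift r a V m n ≡ shift r a W m n
shift-cong {V} {W} r a m n V≗W with shiftView r a m n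
... | outside z            = trans (z V) (sym (z W))
... | inside m′ n′ p s z = trans (z V) (trans (V≗W m′ n′ p s) (sym (z W)))

shift-+ : ∀ r a V W m n →
          shift r a (λ m n → V m n ℤ.+ W m n) m n ≡ shift r a V m n ℤ.+ shift r a W m n
shift-+ r a V W m n with shiftView r a m n
... | outside z            = trans (z _) (sym (cong₂ ℤ._+_ (z V) (z W)))
... | inside m′ n′ _ _ z = trans (z _) (sym (cong₂ ℤ._+_ (z V) (z W)))

shift-zero : ∀ r a m n → shift r a (λ _ _ → 0ℤ) m n ≡ 0ℤ
shift-zero r a m n with shiftView r a m n
... | outside z          = z _
... | inside _ _ _ _ z   = z _

-- `shift` strips x before q, so the clause that does not follow by unfolding is the last: there an
-- inner x has to be moved past an outer power of q, which is `cancel-x`.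
shift-shift : ∀ r a r′ a′ V m n →
              shift r a (shift r′ a′ V) m n ≡ shift (r + r′) (a + a′) V m n
shift-shift zero    zero    r′       a′ V m n       = refl
shift-shift (suc r) a       r′       a′ V zero    n = refl
shift-shift (suc r) a       r′       a′ V (suc m) n = shift-shift r a r′ a′ V m n
shift-shift zero    (suc a) zero     a′ V m zero    = refl
shift-shift zero    (suc a) zero     a′ V m (suc n) = shift-shift zero a zero a′ V m n
shift-shift zero    (suc a) (suc r′) a′ V zero    zero    = refl
shift-shift zero    (suc a) (suc r′) a′ V zero    (suc n) = shift-shift zero a (suc r′) a′ V zero n
shift-shift zero    (suc a) (suc r′) a′ V (suc m) n       =
  trans (cancel-x (suc a) n) (shift-shift zero (suc a) r′ a′ V m n)
  where
  cancel-x : ∀ b n → shift zero b (shift (suc r′) a′ V) (suc m) n ≡ shift zero b (shift r′ a′ V) m n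
  cancel-x zero    n       = refl
  cancel-x (suc b) zero    = refl
  cancel-x (suc b) (suc n) = cancel-x b n

-- Terms of the triple series

term : ℕ → ℕ → ℤ → ℤ⟦q⟧ → ℤ⟦x,q⟧
term N E c D = x^ N · c • (q^ E ⊛ D)

shift-term : ∀ r a N E c D m n →
             shift r a (term N E c D) m n ≡ term (r + N) (a + E) c D m n
shift-term zero    zero    N E c D m       n = refl
shift-term (suc r) a       N E c D zero    n = refl
shift-term (suc r) a       N E c D (suc m) n = trans (shift-term r a N E c D m n)
  (cong (if_then (c • (q^ (a + E) ⊛ D)) n else 0ℤ) (sym (⌊suc≟suc⌋ m (r + N))))
shift-term zero    (suc a) N E c D m zero with ⌊ m ℕ.≟ N ⌋
... | true  = sym (ℤ.*-zeroʳ c)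
... | false = refl
shift-term zero    (suc a) N E c D m (suc n) = trans (shift-term zero a N E c D m n)
  (cong (if ⌊ m ℕ.≟ N ⌋ then_else 0ℤ) (cong (c ℤ.*_) (sym (q^-suc-⊛ (a + E) D n))))

term-vanishes : ∀ N E c D m n → m ≢ N → term N E c D m n ≡ 0ℤ
term-vanishes N E c D m n m≢N with m ℕ.≟ N
... | yes m≡N = ⊥-elim (m≢N m≡N)
... | no  _   = refl

-- With D′ = (1 - q^e) D this is D = q^e D + D′, multiplied by a monomial. In the use below, D′ is
-- the reciprocal of a denominator with one factor fewer than that of D.
term-split : ∀ r N a E e c D D′ → D′ ≗ D ⊖ q^ e ⊛ D → ∀ m n →
             term (r + N) (a + E) c D m n ≡
             term (r + N) (e + (a + E)) c D m n ℤ.+ shift r a (term N E c D′) m n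
term-split r N a E e c D D′ D′≗ m n =
  trans split (cong (ℤ._+_ (term (r + N) (e + (a + E)) c D m n))
    (sym (shift-term r a N E c D′ m n)))
  where
  F = a + E
  product : (q^ F ⊛ D′) n ≡ -1ℤ ℤ.* (q^ (e + F) ⊛ D) n ℤ.+ (q^ F ⊛ D) n
  product = begin
    (q^ F ⊛ D′) n
      ≡⟨ ⊛-comm (q^ F) D′ n ⟩
    (D′ ⊛ q^ F) n
      ≡⟨ ⊛-congʳ (q^ F) (λ k → trans (D′≗ k) (rearrange (D k) ((q^ e ⊛ D) k))) n ⟩
    ((λ k → -1ℤ ℤ.* (q^ e ⊛ D) k ℤ.+ D k) ⊛ q^ F) n
      ≡⟨ ⊛-linearˡ -1ℤ (q^ e ⊛ D) D (q^ F) n ⟩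
    -1ℤ ℤ.* (q^ e ⊛ D ⊛ q^ F) n ℤ.+ (D ⊛ q^ F) n
      ≡⟨ cong₂ (λ x y → -1ℤ ℤ.* x ℤ.+ y)
           (trans (⊛-swap (q^ e) D (q^ F) n) (⊛-congʳ D (q^-⊛ e F) n))
           (⊛-comm D (q^ F) n) ⟩
    -1ℤ ℤ.* (q^ (e + F) ⊛ D) n ℤ.+ (q^ F ⊛ D) n ∎
    where
    open ≡-Reasoning
    rearrange : ∀ x y → x ℤ.- y ≡ -1ℤ ℤ.* y ℤ.+ x
    rearrange = solve-∀
  rearrange : ∀ c x y → c ℤ.* x ≡ c ℤ.* y ℤ.+ c ℤ.* (-1ℤ ℤ.* y ℤ.+ x)
  rearrange = solve-∀
  split : term (r + N) F c D m n ≡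
          term (r + N) (e + F) c D m n ℤ.+ term (r + N) F c D′ m n
  split with ⌊ m ℕ.≟ r + N ⌋
  ... | false = refl
  ... | true  = trans (rearrange c ((q^ F ⊛ D) n) ((q^ (e + F) ⊛ D) n))
                      (cong (λ z → c ℤ.* (q^ (e + F) ⊛ D) n ℤ.+ c ℤ.* z) (sym product))

-- Sums over boxes

sum< : ℕ → (ℕ → ℤ) → ℤ
sum< zero    f = 0ℤ
sum< (suc n) f = f 0 ℤ.+ sum< n (λ i → f (suc i))

sum<-cong : ∀ n {f g} → f ≗ g → sum< n f ≡ sum< n g
sum<-cong zero    f≗g = refl
sum<-cong (suc n) f≗g = cong₂ ℤ._+_ (f≗g 0) (sum<-cong n (λ i → f≗g (suc i)))

sum<-zero : ∀ n {f} → (∀ i → f i ≡ 0ℤ) → sum< n f ≡ 0ℤ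
sum<-zero zero    f≡0 = refl
sum<-zero (suc n) f≡0 = cong₂ ℤ._+_ (f≡0 0) (sum<-zero n (λ i → f≡0 (suc i)))

sum<-suc : ∀ n f → f 0 ≡ 0ℤ → sum< (suc n) f ≡ sum< n (λ i → f (suc i))
sum<-suc n f f₀≡0 = trans (cong (ℤ._+ sum< n (λ i → f (suc i))) f₀≡0) (ℤ.+-identityˡ _)

sum<-+ : ∀ n f g → sum< n (λ i → f i ℤ.+ g i) ≡ sum< n f ℤ.+ sum< n g
sum<-+ zero    f g = refl
sum<-+ (suc n) f g = trans
  (cong (ℤ._+_ (f 0 ℤ.+ g 0)) (sum<-+ n (λ i → f (suc i)) (λ i → g (suc i))))
  (rearrange (f 0) (g 0) (sum< n (λ i → f (suc i))) (sum< n (λ i → g (suc i))))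
  where
  rearrange : ∀ a b c d → a ℤ.+ b ℤ.+ (c ℤ.+ d) ≡ a ℤ.+ c ℤ.+ (b ℤ.+ d)
  rearrange = solve-∀

sum<-stable : ∀ {m n f} → m ℕ.≤ n → (∀ i → m ℕ.≤ i → f i ≡ 0ℤ) → sum< n f ≡ sum< m f
sum<-stable {n = n} z≤n       f≡0 = sum<-zero n (λ i → f≡0 i z≤n)
sum<-stable {f = f} (s≤s m≤n) f≡0 =
  cong (ℤ._+_ (f 0)) (sum<-stable m≤n (λ i m≤i → f≡0 (suc i) (s≤s m≤i)))

Family : Set
Family = ℕ → ℕ → ℕ → ℤ⟦x,q⟧

sum³ : ℕ → ℕ → ℕ → Family → ℤ⟦x,q⟧
sum³ A B C F m n = sum< A (λ i → sum< B (λ j → sum< C (λ k → F i j k m n)))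

sum³-cong : ∀ A B C (F G : Family) m n → (∀ i j k → F i j k m n ≡ G i j k m n) →
            sum³ A B C F m n ≡ sum³ A B C G m n
sum³-cong A B C F G m n F≗G =
  sum<-cong A (λ i → sum<-cong B (λ j → sum<-cong C (λ k → F≗G i j k)))

sum³-+ : ∀ A B C (F G : Family) m n →
         sum³ A B C (λ i j k m n → F i j k m n ℤ.+ G i j k m n) m n ≡
         sum³ A B C F m n ℤ.+ sum³ A B C G m n
sum³-+ A B C F G m n = trans
  (sum<-cong A (λ i → trans (sum<-cong B (λ j → sum<-+ C _ _)) (sum<-+ B _ _)))
  (sum<-+ A _ _)

sum³-zero : ∀ A B C (F : Family) m n → (∀ i j k → F i j k m n ≡ 0ℤ) → sum³ A B C F m n ≡ 0ℤ
sum³-zero A B C F m n F≡0 =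
  sum<-zero A (λ i → sum<-zero B (λ j → sum<-zero C (λ k → F≡0 i j k)))

sum³-shift : ∀ A B C (F : Family) r a m n →
             sum³ A B C (λ i j k → shift r a (F i j k)) m n ≡ shift r a (sum³ A B C F) m n
sum³-shift A B C F r a m n with shiftView r a m n
... | outside z            = trans
  (sum³-zero A B C (λ i j k → shift r a (F i j k)) m n (λ i j k → z (F i j k))) (sym (z _))
... | inside m′ n′ _ _ z = trans
  (sum<-cong A (λ i → sum<-cong B (λ j → sum<-cong C (λ k → z (F i j k))))) (sym (z _))

-- Graded families and their totals

degree : ℕ → ℕ → ℕ → ℕ
degree i j k = i + 2 * j + 3 * k

Graded : Family → Set
Graded F = ∀ i j k m n → m ≢ degree i j k → F i j k m n ≡ 0ℤ

-- For a graded family the terms outside the box do not contribute.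
total : Family → ℤ⟦x,q⟧
total F m = sum³ (suc m) (suc m) (suc m) F m

i≤degree : ∀ i j k → i ℕ.≤ degree i j k
i≤degree i j k = ℕ.≤-trans (ℕ.m≤m+n i (2 * j)) (ℕ.m≤m+n _ (3 * k))

j≤degree : ∀ i j k → j ℕ.≤ degree i j k
j≤degree i j k = ℕ.≤-trans (ℕ.m≤n*m j 2) (ℕ.≤-trans (ℕ.m≤n+m (2 * j) i) (ℕ.m≤m+n _ (3 * k)))

k≤degree : ∀ i j k → k ℕ.≤ degree i j k
k≤degree i j k = ℕ.≤-trans (ℕ.m≤n*m k 3) (ℕ.m≤n+m (3 * k) (i + 2 * j))

-- Each index is at most the degree, so an index above `m` rules out degree `m`. The three sides are
-- independent because delaying one index shortens the box in that direction only.
total-stable : ∀ {F A B C} → Graded F → ∀ m n →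
               m ℕ.< A → m ℕ.< B → m ℕ.< C → sum³ A B C F m n ≡ total F m n
total-stable {F} {A} {B} {C} graded m n m<A m<B m<C = trans
  (sum<-stable m<A (λ i m<i → sum<-zero B (λ j → sum<-zero C (λ k →
    graded i j k m n (ℕ.<⇒≢ (ℕ.≤-trans m<i (i≤degree i j k)))))))
  (sum<-cong (suc m) (λ i → trans
    (sum<-stable m<B (λ j m<j → sum<-zero C (λ k →
      graded i j k m n (ℕ.<⇒≢ (ℕ.≤-trans m<j (j≤degree i j k))))))
    (sum<-cong (suc m) (λ j → sum<-stable m<C (λ k m<k →
      graded i j k m n (ℕ.<⇒≢ (ℕ.≤-trans m<k (k≤degree i j k))))))))

-- Pairs the term at index i+1 of one family with the term at i of another; index 0 has no partner
-- and gets the zero series.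
delay : (ℕ → ℤ⟦x,q⟧) → ℕ → ℤ⟦x,q⟧
delay F zero    = λ _ _ → 0ℤ
delay F (suc i) = F i

-- Since `r` is positive, the shift reads only powers of x below `m`. At those powers the box,
-- although it loses a layer to the delay, still contains all contributing terms.
total-shift : ∀ (F G H H′ : Family) r a → 0 ℕ.< r →
  (∀ m m′ n′ → m′ ℕ.< m → sum³ (suc m) (suc m) (suc m) H′ m′ n′ ≡ total H m′ n′) →
  ∀ m n →
  (∀ i j k → F i j k m n ≡ G i j k m n ℤ.+ shift r a (H′ i j k) m n) →
  total F m n ≡ total G m n ℤ.+ shift r a (total H) m n
total-shift F G H H′ r a 0<r H′-sum m n F≗ = begin
  total F m n
    ≡⟨ sum³-cong (suc m) (suc m) (suc m) F
         (λ i j k m n → G i j k m n ℤ.+ shift r a (H′ i j k) m n) m n F≗ ⟩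
  sum³ (suc m) (suc m) (suc m) (λ i j k m n → G i j k m n ℤ.+ shift r a (H′ i j k) m n) m n
    ≡⟨ sum³-+ (suc m) (suc m) (suc m) G (λ i j k → shift r a (H′ i j k)) m n ⟩
  total G m n ℤ.+ sum³ (suc m) (suc m) (suc m) (λ i j k → shift r a (H′ i j k)) m n
    ≡⟨ cong (ℤ._+_ (total G m n)) (trans
         (sum³-shift (suc m) (suc m) (suc m) H′ r a m n)
         (shift-cong r a m n (λ m′ n′ m≡ _ →
           H′-sum m m′ n′ (subst (m′ ℕ.<_) (sym m≡) (ℕ.m<n+m m′ 0<r))))) ⟩
  total G m n ℤ.+ shift r a (total H) m n ∎
  where open ≡-Reasoning

module _ (F G H : Family) (r a : ℕ) (0<r : 0 ℕ.< r) (graded : Graded H) where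

  private
    base : ∀ m n {f g} → f ≡ g → f ≡ g ℤ.+ shift r a (λ _ _ → 0ℤ) m n
    base m n {f} {g} f≡g = trans f≡g
      (sym (trans (cong (ℤ._+_ g) (shift-zero r a m n)) (ℤ.+-identityʳ g)))

  total-shift-i :
    (∀ j k m n → F 0 j k m n ≡ G 0 j k m n) →
    (∀ i j k m n → F (suc i) j k m n ≡ G (suc i) j k m n ℤ.+ shift r a (H i j k) m n) →
    ∀ m n → total F m n ≡ total G m n ℤ.+ shift r a (total H) m n
  total-shift-i F₀≗G₀ step m n =
    total-shift F G H (λ i j k → delay (λ i → H i j k) i) r a 0<r
      (λ m m′ n′ m′<m → trans
        (sum<-suc m (λ i → sum< (suc m) (λ j → sum< (suc m) (λ k → delay (λ i → H i j k) i m′ n′)))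
          (sum<-zero (suc m) (λ j → sum<-zero (suc m) (λ k → refl))))
        (total-stable graded m′ n′ m′<m (ℕ.m<n⇒m<1+n m′<m) (ℕ.m<n⇒m<1+n m′<m)))
      m n
      λ { zero j k → base m n (F₀≗G₀ j k m n) ; (suc i) j k → step i j k m n }

  total-shift-j :
    (∀ i k m n → F i 0 k m n ≡ G i 0 k m n) →
    (∀ i j k m n → F i (suc j) k m n ≡ G i (suc j) k m n ℤ.+ shift r a (H i j k) m n) →
    ∀ m n → total F m n ≡ total G m n ℤ.+ shift r a (total H) m n
  total-shift-j F₀≗G₀ step m n =
    total-shift F G H (λ i j k → delay (λ j → H i j k) j) r a 0<r
      (λ m m′ n′ m′<m → trans
        (sum<-cong (suc m) (λ i →
          sum<-suc m (λ j → sum< (suc m) (λ k → delay (λ j → H i j k) j m′ n′))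
            (sum<-zero (suc m) (λ k → refl))))
        (total-stable graded m′ n′ (ℕ.m<n⇒m<1+n m′<m) m′<m (ℕ.m<n⇒m<1+n m′<m)))
      m n
      λ { i zero k → base m n (F₀≗G₀ i k m n) ; i (suc j) k → step i j k m n }

  total-shift-k :
    (∀ i j m n → F i j 0 m n ≡ G i j 0 m n) →
    (∀ i j k m n → F i j (suc k) m n ≡ G i j (suc k) m n ℤ.+ shift r a (H i j k) m n) →
    ∀ m n → total F m n ≡ total G m n ℤ.+ shift r a (total H) m n
  total-shift-k F₀≗G₀ step m n =
    total-shift F G H (λ i j k → delay (λ k → H i j k) k) r a 0<r
      (λ m m′ n′ m′<m → trans
        (sum<-cong (suc m) (λ i → sum<-cong (suc m) (λ j →
          sum<-suc m (λ k → delay (H i j) k m′ n′) refl)))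
        (total-stable graded m′ n′ (ℕ.m<n⇒m<1+n m′<m) (ℕ.m<n⇒m<1+n m′<m) m′<m))
      m n
      λ { i j zero → base m n (F₀≗G₀ i j m n) ; i j (suc k) → step i j k m n }

-- Contiguity relations

exponent : ℕ → ℕ → ℕ → ℕ → ℕ → ℕ → ℕ
exponent a b c i j k = a * i + b * j + 3 * k ^ 2 + c * k

summands : ℕ → ℕ → ℕ → Family
summands a b c i j k = summand (exponent a b c) (i , j , k)

S : ℕ → ℕ → ℕ → ℤ⟦x,q⟧
S a b c = total (summands a b c)

summand-graded : ∀ e → Graded (λ i j k → summand e (i , j , k))
summand-graded e i j k m n m≢N =
  term-vanishes (degree i j k) (degree i j k * (degree i j k ∸ 1) + e i j k) (-1ℤ ℤ.^ k)
    (1/ denominator i j k) m n m≢N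

-- The cross term 2(r+1)n is what raises the parameters by 2(r+1) times 1, 2, 3 when N drops by r+1
-- in a contiguity relation.
pronic-+ : ∀ r n → (suc r + n) * (r + n) ≡ n * (n ∸ 1) + (2 * suc r * n + suc r * r)
pronic-+ r n = trans (expand r n) (trans
  (cong (λ z → z + ((1 + 2 * r) * n + suc r * r)) (square n))
  (collect r n (n * (n ∸ 1))))
  where
  square : ∀ n → n * n ≡ n * (n ∸ 1) + n
  square zero    = refl
  square (suc n) = trans (ℕ.*-suc (suc n) n) (ℕ.+-comm (suc n) (suc n * n))
  expand : ∀ r n → (suc r + n) * (r + n) ≡ n * n + ((1 + 2 * r) * n + suc r * r)
  expand = ℕ-Solver.solve-∀
  collect : ∀ r n p → p + n + ((1 + 2 * r) * n + suc r * r) ≡ p + (2 * suc r * n + suc r * r)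
  collect = ℕ-Solver.solve-∀

term-cong : ∀ {N N′ E E′} c D m n → N ≡ N′ → E ≡ E′ → term N E c D m n ≡ term N′ E′ c D m n
term-cong c D m n refl refl = refl

term-neg : ∀ N E c D m n → term N E (-1ℤ ℤ.* c) D m n ≡ ℤ.- term N E c D m n
term-neg N E c D m n with ⌊ m ℕ.≟ N ⌋
... | false = refl
... | true  = rearrange c ((q^ E ⊛ D) n)
  where
  rearrange : ∀ c x → -1ℤ ℤ.* c ℤ.* x ≡ ℤ.- (c ℤ.* x)
  rearrange = solve-∀

pronicTerm : ℕ → ℕ → ℤ → ℤ⟦q⟧ → ℤ⟦x,q⟧
pronicTerm N e = term N (N * (N ∸ 1) + e)

-- Here 1 - q^d is the cancelled factor. The first equation on exponents absorbs the change of
-- N(N-1) into the new parameters and the monomial; the second says that multiplication by q^d only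
-- raises one parameter.
pronicTerm-split : ∀ r a d {N N′ e e′ e″} c D D′ → N ≡ suc r + N′ →
  2 * suc r * N′ + suc r * r + e ≡ a + e′ → e″ ≡ d + e →
  D′ ≗ D ⊖ q^ d ⊛ D → ∀ m n →
  pronicTerm N e c D m n ≡ pronicTerm N e″ c D m n ℤ.+ shift (suc r) a (pronicTerm N′ e′ c D′) m n
pronicTerm-split r a d {N} {N′} {e} {e′} {e″} c D D′ refl e≡ refl D′≗ m n = begin
  term N (N * (r + N′) + e) c D m n
    ≡⟨ term-cong c D m n refl exponents ⟩
  term N (a + (p + e′)) c D m n
    ≡⟨ term-split (suc r) N′ a (p + e′) d c D D′ D′≗ m n ⟩
  term N (d + (a + (p + e′))) c D m n ℤ.+ shift (suc r) a (term N′ (p + e′) c D′) m n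
    ≡⟨ cong (ℤ._+ shift (suc r) a (term N′ (p + e′) c D′) m n)
         (term-cong c D m n refl (trans (cong (d +_) (sym exponents)) (swap d (N * (r + N′)) e))) ⟩
  term N (N * (r + N′) + (d + e)) c D m n ℤ.+ shift (suc r) a (term N′ (p + e′) c D′) m n ∎
  where
  open ≡-Reasoning
  p = N′ * (N′ ∸ 1)
  swap : ∀ x y z → x + (y + z) ≡ y + (x + z)
  swap = ℕ-Solver.solve-∀
  exponents : N * (r + N′) + e ≡ a + (p + e′)
  exponents = trans (cong (_+ e) (pronic-+ r N′))
    (trans (ℕ.+-assoc p _ e) (trans (cong (p +_) e≡) (swap p a e′)))

-- For i ≥ 1, 1/(q;q)_i = q^i/(q;q)_i + 1/(q;q)_(i-1). The first piece raises `a` by 1. In the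
-- second, N drops by 1 and N(N-1) by 2(N-1), whence the increments 2, 4, 6.
S-i : ∀ a b c m n →
      S a b c m n ≡ S (1 + a) b c m n ℤ.+ shift 1 a (S (2 + a) (4 + b) (6 + c)) m n
S-i a b c = total-shift-i (summands a b c) (summands (1 + a) b c)
  (summands (2 + a) (4 + b) (6 + c)) 1 a (s≤s z≤n)
  (summand-graded (exponent (2 + a) (4 + b) (6 + c)))
  (λ j k m n → term-cong {degree 0 j k} (-1ℤ ℤ.^ k) (1/ denominator 0 j k) m n refl
    (cong (λ z → degree 0 j k * (degree 0 j k ∸ 1) + (z + b * j + 3 * (k * (k * 1)) + c * k))
      (trans (ℕ.*-zeroʳ a) (sym (ℕ.*-zeroʳ (1 + a))))))
  (λ i j k → pronicTerm-split 0 a (suc i * 1) (-1ℤ ℤ.^ k)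
    (1/ denominator (suc i) j k) (1/ denominator i j k)
    refl (exponents a b c i j k) (exponents′ a b c i j k)
    (λ l → trans (1/denominator-i i j k l) (factor-⊛ 1 i (1/ denominator (suc i) j k) l)))
  where
  -- The solver does not recognise powers, so k ^ 2 is written in its unfolded form.
  exponents : ∀ a b c i j k →
    2 * 1 * (i + 2 * j + 3 * k) + 1 * 0 + (a * suc i + b * j + 3 * (k * (k * 1)) + c * k) ≡
    a + ((2 + a) * i + (4 + b) * j + 3 * (k * (k * 1)) + (6 + c) * k)
  exponents = ℕ-Solver.solve-∀
  exponents′ : ∀ a b c i j k →
    (1 + a) * suc i + b * j + 3 * (k * (k * 1)) + c * k ≡
    suc i * 1 + (a * suc i + b * j + 3 * (k * (k * 1)) + c * k)
  exponents′ = ℕ-Solver.solve-∀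

-- The same with the factor 1 - q^(4j): N drops by 2 and N(N-1) by 4(N-2) + 2, whence the increments
-- 4, 8, 12 and the 2 in `2 + b`.
S-j : ∀ a b c m n →
      S a b c m n ≡ S a (4 + b) c m n ℤ.+ shift 2 (2 + b) (S (4 + a) (8 + b) (12 + c)) m n
S-j a b c = total-shift-j (summands a b c) (summands a (4 + b) c)
  (summands (4 + a) (8 + b) (12 + c)) 2 (2 + b) (s≤s z≤n)
  (summand-graded (exponent (4 + a) (8 + b) (12 + c)))
  (λ i k m n → term-cong {degree i 0 k} (-1ℤ ℤ.^ k) (1/ denominator i 0 k) m n refl
    (cong (λ z → degree i 0 k * (degree i 0 k ∸ 1) + (a * i + z + 3 * (k * (k * 1)) + c * k))
      (trans (ℕ.*-zeroʳ b) (sym (ℕ.*-zeroʳ (4 + b))))))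
  (λ i j k → pronicTerm-split 1 (2 + b) (suc j * 4) (-1ℤ ℤ.^ k)
    (1/ denominator i (suc j) k) (1/ denominator i j k)
    (degrees i j k) (exponents a b c i j k) (exponents′ a b c i j k)
    (λ l → trans (1/denominator-j i j k l) (factor-⊛ 4 j (1/ denominator i (suc j) k) l)))
  where
  degrees : ∀ i j k → i + 2 * suc j + 3 * k ≡ 2 + (i + 2 * j + 3 * k)
  degrees = ℕ-Solver.solve-∀
  exponents : ∀ a b c i j k →
    2 * 2 * (i + 2 * j + 3 * k) + 2 * 1 + (a * i + b * suc j + 3 * (k * (k * 1)) + c * k) ≡
    2 + b + ((4 + a) * i + (8 + b) * j + 3 * (k * (k * 1)) + (12 + c) * k)
  exponents = ℕ-Solver.solve-∀
  exponents′ : ∀ a b c i j k →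
    a * i + (4 + b) * suc j + 3 * (k * (k * 1)) + c * k ≡
    suc j * 4 + (a * i + b * suc j + 3 * (k * (k * 1)) + c * k)
  exponents′ = ℕ-Solver.solve-∀

-- The same with the factor 1 - q^(6k). Lowering k flips the sign (-1)^k, so the shifted series
-- appears negated and is moved to the other side. The drop of 3k² adds 6k + 3, which makes the last
-- increment 18 + 6 and the constant 6 + 3.
S-k : ∀ a b c m n →
      S a b (6 + c) m n ≡ S a b c m n ℤ.+ shift 3 (9 + c) (S (6 + a) (12 + b) (24 + c)) m n
S-k a b c = total-shift-k (summands a b (6 + c)) (summands a b c)
  (summands (6 + a) (12 + b) (24 + c)) 3 (9 + c) (s≤s z≤n)
  (summand-graded (exponent (6 + a) (12 + b) (24 + c)))
  (λ i j m n → term-cong {degree i j 0} 1ℤ (1/ denominator i j 0) m n refl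
    (cong (λ z → degree i j 0 * (degree i j 0 ∸ 1) + (a * i + b * j + 0 + z))
      (trans (ℕ.*-zeroʳ (6 + c)) (sym (ℕ.*-zeroʳ c)))))
  (λ i j k m n → let N = degree i j k ; e = exponent (6 + a) (12 + b) (24 + c) i j k in
    transpose (trans
      (pronicTerm-split 2 (9 + c) (suc k * 6) (-1ℤ ℤ.* -1ℤ ℤ.^ k)
        (1/ denominator i j (suc k)) (1/ denominator i j k)
        (degrees i j k) (exponents a b c i j k) (exponents′ a b c i j k)
        (λ l → trans (1/denominator-k i j k l) (factor-⊛ 6 k (1/ denominator i j (suc k)) l)) m n)
      (cong (ℤ._+_ (summands a b (6 + c) i j (suc k) m n)) (trans
        (shift-term 3 (9 + c) N (N * (N ∸ 1) + e) (-1ℤ ℤ.* -1ℤ ℤ.^ k) (1/ denominator i j k) m n)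
        (trans (term-neg (3 + N) (9 + c + (N * (N ∸ 1) + e)) (-1ℤ ℤ.^ k) (1/ denominator i j k) m n)
          (cong ℤ.-_ (sym
            (shift-term 3 (9 + c) N (N * (N ∸ 1) + e) (-1ℤ ℤ.^ k) (1/ denominator i j k) m n))))))))
  where
  transpose : ∀ {x y z} → x ≡ y ℤ.+ (ℤ.- z) → y ≡ x ℤ.+ z
  transpose {x} {y} {z} refl = cancel y z
    where
    cancel : ∀ y z → y ≡ y ℤ.+ (ℤ.- z) ℤ.+ z
    cancel = solve-∀
  degrees : ∀ i j k → i + 2 * j + 3 * suc k ≡ 3 + (i + 2 * j + 3 * k)
  degrees = ℕ-Solver.solve-∀
  exponents : ∀ a b c i j k →
    2 * 3 * (i + 2 * j + 3 * k) + 3 * 2 + (a * i + b * j + 3 * (suc k * (suc k * 1)) + c * suc k) ≡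
    9 + c + ((6 + a) * i + (12 + b) * j + 3 * (k * (k * 1)) + (24 + c) * k)
  exponents = ℕ-Solver.solve-∀
  exponents′ : ∀ a b c i j k →
    a * i + b * j + 3 * (suc k * (suc k * 1)) + (6 + c) * suc k ≡
    suc k * 6 + (a * i + b * j + 3 * (suc k * (suc k * 1)) + c * suc k)
  exponents′ = ℕ-Solver.solve-∀

open ≡-Reasoning

-- The identity E = 0 of the header, with x replaced by xqˢ, by induction on the
-- power m < b of x; t and u stand for 2s and 3s, but only u ≡ s + t matters.
S-E : ∀ b s t u → u ≡ s + t → ∀ m n → m ℕ.< b →
      S (7 + s) (14 + t) (18 + u) m n ≡
      S (8 + s) (14 + t) (24 + u) m n ℤ.+ shift 1 (7 + s) (S (9 + s) (22 + t) (30 + u)) m n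
S-E (suc b) s t u u≡s+t m n (s≤s m≤b) = begin
  S (7 + s) (14 + t) (18 + u) m n
    ≡⟨ S-i (7 + s) (14 + t) (18 + u) m n ⟩
  S (8 + s) (14 + t) (18 + u) m n ℤ.+ shift 1 (7 + s) (S (9 + s) (18 + t) (24 + u)) m n
    ≡⟨ cong (ℤ._+_ (S (8 + s) (14 + t) (18 + u) m n)) left ⟩
  S (8 + s) (14 + t) (18 + u) m n ℤ.+ (x₁ ℤ.+ (x₂ ℤ.+ x₃))
    ≡⟨ rearrange (S (8 + s) (14 + t) (18 + u) m n) x₁ x₂ x₃ ⟩
  S (8 + s) (14 + t) (18 + u) m n ℤ.+ x₂ ℤ.+ (x₁ ℤ.+ x₃)
    ≡⟨ cong₂ ℤ._+_ (sym (S-k (8 + s) (14 + t) (18 + u) m n)) (sym right) ⟩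
  S (8 + s) (14 + t) (24 + u) m n ℤ.+ shift 1 (7 + s) (S (9 + s) (22 + t) (30 + u)) m n ∎
  where
  rearrange : ∀ w x y z → w ℤ.+ (x ℤ.+ (y ℤ.+ z)) ≡ w ℤ.+ y ℤ.+ (x ℤ.+ z)
  rearrange = solve-∀
  x₁ = shift 1 (7 + s) (S (9 + s) (22 + t) (24 + u)) m n
  x₂ = shift 3 (27 + u) (S (14 + s) (26 + t) (42 + u)) m n
  x₃ = shift 4 (40 + (s + u)) (S (15 + s) (34 + t) (48 + u)) m n
  arith₁ : ∀ s t → 7 + s + (20 + t) ≡ 27 + (s + t)
  arith₁ = ℕ-Solver.solve-∀
  arith₂ : ∀ s u → 27 + u + (13 + s) ≡ 40 + (s + u)
  arith₂ = ℕ-Solver.solve-∀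
  arith₃ : ∀ s u → 7 + s + (33 + u) ≡ 40 + (s + u)
  arith₃ = ℕ-Solver.solve-∀
  arith₄ : ∀ s t → 18 + (s + t) ≡ 6 + s + (12 + t)
  arith₄ = ℕ-Solver.solve-∀
  right : shift 1 (7 + s) (S (9 + s) (22 + t) (30 + u)) m n ≡ x₁ ℤ.+ x₃
  right = begin
    shift 1 (7 + s) (S (9 + s) (22 + t) (30 + u)) m n
      ≡⟨ shift-cong 1 (7 + s) m n (λ m′ n′ _ _ → S-k (9 + s) (22 + t) (24 + u) m′ n′) ⟩
    shift 1 (7 + s) (λ m n → S (9 + s) (22 + t) (24 + u) m n ℤ.+
                             shift 3 (33 + u) (S (15 + s) (34 + t) (48 + u)) m n) m n
      ≡⟨ shift-+ 1 (7 + s) (S (9 + s) (22 + t) (24 + u))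
           (shift 3 (33 + u) (S (15 + s) (34 + t) (48 + u))) m n ⟩
    x₁ ℤ.+ shift 1 (7 + s) (shift 3 (33 + u) (S (15 + s) (34 + t) (48 + u))) m n
      ≡⟨ cong (ℤ._+_ x₁) (trans (shift-shift 1 (7 + s) 3 (33 + u) (S (15 + s) (34 + t) (48 + u)) m n)
           (cong (λ e → shift 4 e (S (15 + s) (34 + t) (48 + u)) m n) (arith₃ s u))) ⟩
    x₁ ℤ.+ x₃ ∎
  left : shift 1 (7 + s) (S (9 + s) (18 + t) (24 + u)) m n ≡ x₁ ℤ.+ (x₂ ℤ.+ x₃)
  left = begin
    shift 1 (7 + s) (S (9 + s) (18 + t) (24 + u)) m n
      ≡⟨ shift-cong 1 (7 + s) m n (λ m′ n′ _ _ → S-j (9 + s) (18 + t) (24 + u) m′ n′) ⟩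
    shift 1 (7 + s) (λ m n → S (9 + s) (22 + t) (24 + u) m n ℤ.+
                             shift 2 (20 + t) (S (13 + s) (26 + t) (36 + u)) m n) m n
      ≡⟨ shift-+ 1 (7 + s) (S (9 + s) (22 + t) (24 + u))
           (shift 2 (20 + t) (S (13 + s) (26 + t) (36 + u))) m n ⟩
    x₁ ℤ.+ shift 1 (7 + s) (shift 2 (20 + t) (S (13 + s) (26 + t) (36 + u))) m n
      ≡⟨ cong (ℤ._+_ x₁) (begin
        shift 1 (7 + s) (shift 2 (20 + t) (S (13 + s) (26 + t) (36 + u))) m n
          ≡⟨ shift-shift 1 (7 + s) 2 (20 + t) (S (13 + s) (26 + t) (36 + u)) m n ⟩
        shift 3 (7 + s + (20 + t)) (S (13 + s) (26 + t) (36 + u)) m n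
          ≡⟨ cong (λ e → shift 3 e (S (13 + s) (26 + t) (36 + u)) m n)
               (trans (arith₁ s t) (cong (27 +_) (sym u≡s+t))) ⟩
        shift 3 (27 + u) (S (13 + s) (26 + t) (36 + u)) m n
          -- The factor x³ lowers the power of x, so the inductive hypothesis applies with xq⁶ for
          -- x: `s`, `t`, `u` grow by 6, 12, 18.
          ≡⟨ shift-cong 3 (27 + u) m n (λ m′ n′ m≡ _ →
               S-E b (6 + s) (12 + t) (18 + u) (trans (cong (18 +_) u≡s+t) (arith₄ s t)) m′ n′
                 (ℕ.≤-trans (subst (m′ ℕ.<_) (sym m≡) (ℕ.m<n+m m′ (s≤s z≤n))) m≤b)) ⟩
        shift 3 (27 + u) (λ m n → S (14 + s) (26 + t) (42 + u) m n ℤ.+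
                                  shift 1 (13 + s) (S (15 + s) (34 + t) (48 + u)) m n) m n
          ≡⟨ shift-+ 3 (27 + u) (S (14 + s) (26 + t) (42 + u))
               (shift 1 (13 + s) (S (15 + s) (34 + t) (48 + u))) m n ⟩
        x₂ ℤ.+ shift 3 (27 + u) (shift 1 (13 + s) (S (15 + s) (34 + t) (48 + u))) m n
          ≡⟨ cong (ℤ._+_ x₂) (trans (shift-shift 3 (27 + u) 1 (13 + s) (S (15 + s) (34 + t) (48 + u)) m n)
               (cong (λ e → shift 4 e (S (15 + s) (34 + t) (48 + u)) m n) (arith₂ s u))) ⟩
        x₂ ℤ.+ x₃ ∎) ⟩
    x₁ ℤ.+ (x₂ ℤ.+ x₃) ∎

-- The third equation of the overview with xq^s for x. Applying `S-i` and then `S-j` leaves S 7 14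
-- 18 (at s = 0). `S-E` splits it in two: one piece is the Q term, the other is what `S-k` needs to
-- turn S 3 10 6 into the P term.
S-R : ∀ s t u → u ≡ s + t → ∀ m n →
      S (2 + s) (6 + t) (6 + u) m n ≡
      shift 1 (2 + s) (S (4 + s) (10 + t) (12 + u)) m n ℤ.+
      (S (3 + s) (10 + t) (12 + u) m n ℤ.+ shift 2 (8 + t) (S (8 + s) (14 + t) (24 + u)) m n)
S-R s t u u≡s+t m n = begin
  S (2 + s) (6 + t) (6 + u) m n
    ≡⟨ S-i (2 + s) (6 + t) (6 + u) m n ⟩
  S (3 + s) (6 + t) (6 + u) m n ℤ.+ x₁
    ≡⟨ cong (ℤ._+ x₁) (S-j (3 + s) (6 + t) (6 + u) m n) ⟩
  x₀ ℤ.+ shift 2 (8 + t) (S (7 + s) (14 + t) (18 + u)) m n ℤ.+ x₁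
    ≡⟨ cong (λ z → x₀ ℤ.+ z ℤ.+ x₁) middle ⟩
  x₀ ℤ.+ (x₂ ℤ.+ x₃) ℤ.+ x₁
    ≡⟨ rearrange x₀ x₁ x₂ x₃ ⟩
  x₁ ℤ.+ (x₀ ℤ.+ x₃ ℤ.+ x₂)
    ≡⟨ cong (λ z → x₁ ℤ.+ (z ℤ.+ x₂)) (sym (S-k (3 + s) (10 + t) (6 + u) m n)) ⟩
  x₁ ℤ.+ (S (3 + s) (10 + t) (12 + u) m n ℤ.+ x₂) ∎
  where
  rearrange : ∀ w x y z → w ℤ.+ (y ℤ.+ z) ℤ.+ x ≡ x ℤ.+ (w ℤ.+ z ℤ.+ y)
  rearrange = solve-∀
  x₀ = S (3 + s) (10 + t) (6 + u) m n
  x₁ = shift 1 (2 + s) (S (4 + s) (10 + t) (12 + u)) m n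
  x₂ = shift 2 (8 + t) (S (8 + s) (14 + t) (24 + u)) m n
  x₃ = shift 3 (15 + u) (S (9 + s) (22 + t) (30 + u)) m n
  arith : ∀ s t → 8 + t + (7 + s) ≡ 15 + (s + t)
  arith = ℕ-Solver.solve-∀
  middle : shift 2 (8 + t) (S (7 + s) (14 + t) (18 + u)) m n ≡ x₂ ℤ.+ x₃
  middle = begin
    shift 2 (8 + t) (S (7 + s) (14 + t) (18 + u)) m n
      ≡⟨ shift-cong 2 (8 + t) m n (λ m′ n′ _ _ → S-E (suc m′) s t u u≡s+t m′ n′ ℕ.≤-refl) ⟩
    shift 2 (8 + t) (λ m n → S (8 + s) (14 + t) (24 + u) m n ℤ.+
                             shift 1 (7 + s) (S (9 + s) (22 + t) (30 + u)) m n) m n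
      ≡⟨ shift-+ 2 (8 + t) (S (8 + s) (14 + t) (24 + u))
           (shift 1 (7 + s) (S (9 + s) (22 + t) (30 + u))) m n ⟩
    x₂ ℤ.+ shift 2 (8 + t) (shift 1 (7 + s) (S (9 + s) (22 + t) (30 + u))) m n
      ≡⟨ cong (ℤ._+_ x₂) (trans (shift-shift 2 (8 + t) 1 (7 + s) (S (9 + s) (22 + t) (30 + u)) m n)
           (cong (λ e → shift 3 e (S (9 + s) (22 + t) (30 + u)) m n)
             (trans (arith s t) (cong (15 +_) (sym u≡s+t))))) ⟩
    x₂ ℤ.+ x₃ ∎

-- Multiplicities

private
  variable
    a b s n : ℕ
    π : List ℕ

mult-here : ∀ a π → mult a (a ∷ π) ≡ suc (mult a π)
mult-here a π = cong length (List.filter-accept (ℕ._≟ a) {xs = π} refl)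

mult-there : ∀ π → b ≢ a → mult a (b ∷ π) ≡ mult a π
mult-there {b} {a} π b≢a = cong length (List.filter-reject (ℕ._≟ a) {xs = π} b≢a)

mult-≤-∷ : ∀ a b π → mult a π ℕ.≤ mult a (b ∷ π)
mult-≤-∷ a b π with b ℕ.≟ a
... | yes refl = ℕ.≤-trans (ℕ.n≤1+n _) (ℕ.≤-reflexive (sym (mult-here a π)))
... | no  b≢a  = ℕ.≤-reflexive (sym (mult-there π b≢a))

mult-below : All (a ℕ.<_) π → mult a π ≡ 0
mult-below {a} a<π = cong length
  (List.filter-none (ℕ._≟ a) (All.map (λ a<b b≡a → ℕ.<⇒≢ a<b (sym b≡a)) a<π))

∈⇒mult>0 : a ∈ π → 0 ℕ.< mult a π
∈⇒mult>0 {a} {_ ∷ π} (here refl) = subst (0 ℕ.<_) (sym (mult-here a π)) (s≤s z≤n)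
∈⇒mult>0 {a} {b ∷ π} (there a∈π) = ℕ.≤-trans (∈⇒mult>0 a∈π) (mult-≤-∷ a b π)

mult>0⇒∈ : ∀ a π → 0 ℕ.< mult a π → a ∈ π
mult>0⇒∈ a (b ∷ π) 0<mult with b ℕ.≟ a
... | yes refl = here refl
... | no  b≢a  = there (mult>0⇒∈ a π (subst (0 ℕ.<_) (mult-there π b≢a) 0<mult))

-- Even numbers

Even : ℕ → Set
Even s = ∃[ j ] s ≡ 2 * j

even-2+ : Even s → Even (2 + s)
even-2+ (j , refl) = suc j , sym (ℕ.*-suc 2 j)

even-gap : Even a → Even b → a ℕ.< b → 2 + a ℕ.≤ b
even-gap (i , refl) (j , refl) a<b =
  subst (ℕ._≤ 2 * j) (ℕ.*-suc 2 i) (ℕ.*-monoʳ-≤ 2 (ℕ.*-cancelˡ-< 2 i j a<b))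

even≢odd : Even a → ∀ j → a ≢ 2 * j + 1
even≢odd (i , refl) j eq = ℕ.<-irrefl refl
  (ℕ.≤-trans (subst (ℕ._≤ 2 * i) (cong suc (ℕ.+-comm 1 (2 * j))) (even-gap (j , refl) (i , refl)
    (ℕ.≤-reflexive (trans (ℕ.+-comm 1 (2 * j)) (sym eq))))) (ℕ.≤-reflexive eq))

-- The class 𝒞

even-mult≤2 : Even a → 𝒞 π → mult a π ℕ.≤ 2
even-mult≤2 (j , refl) c = 𝒞.evenAtMost2 c j

odd-mult≤1 : Even a → 𝒞 π → mult (1 + a) π ℕ.≤ 1
odd-mult≤1 {π = π} (j , refl) c =
  subst (λ x → mult x π ℕ.≤ 1) (ℕ.+-comm (2 * j) 1) (𝒞.oddDistinct c j)

repeated : Even a → 𝒞 π → mult a π ≡ 2 →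
           a ∸ 3 ∉ π × a ∸ 2 ∉ π × 2 + a ∉ π × 3 + a ∉ π
repeated {π = π} (j , refl) c eq with x , y , z , w ← 𝒞.repeatedEven c j eq =
  x , y , subst (_∉ π) (ℕ.+-comm (2 * j) 2) z , subst (_∉ π) (ℕ.+-comm (2 * j) 3) w

sorted : 𝒞 (a ∷ π) → All (a ℕ.≤_) π
sorted c = All.tail (Linked⇒All ℕ.≤-trans ℕ.≤-refl (proj₂ (𝒞.partition c)))

𝒞-tail : 𝒞 (a ∷ π) → 𝒞 π
𝒞-tail {a} {π} c = record
  { partition     = All.tail (proj₁ partition) , Linked.tail (proj₂ partition)
  ; noConsecutive = λ x (p , r) → noConsecutive x (there p , there r)
  ; oddDistinct   = λ j → ℕ.≤-trans (mult-≤-∷ (2 * j + 1) a π) (oddDistinct j)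
  ; evenAtMost2   = λ j → ℕ.≤-trans (mult-≤-∷ (2 * j) a π) (evenAtMost2 j)
  ; repeatedEven  = λ j eq →
      let x , y , z , w = repeatedEven j (ℕ.≤-antisym (evenAtMost2 j)
            (ℕ.≤-trans (ℕ.≤-reflexive (sym eq)) (mult-≤-∷ (2 * j) a π)))
      in (λ p → x (there p)) , (λ p → y (there p)) , (λ p → z (there p)) , (λ p → w (there p))
  }
  where open 𝒞 c

𝒞-[] : 𝒞 []
𝒞-[] = record
  { partition     = [] , []
  ; noConsecutive = λ { _ (() , _) }
  ; oddDistinct   = λ _ → z≤n
  ; evenAtMost2   = λ _ → z≤n
  ; repeatedEven  = λ _ ()
  }

linked-∷ : All (a ℕ.≤_) π → Linked ℕ._≤_ π → Linked ℕ._≤_ (a ∷ π)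
linked-∷ []        []       = [-]
linked-∷ (a≤b ∷ _) [-]      = a≤b ∷ [-]
linked-∷ (a≤b ∷ _) (r ∷ rs) = a≤b ∷ r ∷ rs

∉-∷ : ∀ {x} → x ≢ a → x ∉ π → x ∉ a ∷ π
∉-∷ x≢a x∉π (here x≡a)  = x≢a x≡a
∉-∷ x≢a x∉π (there x∈π) = x∉π x∈π

below⇒∉ : All (a ℕ.<_) π → a ∉ π
below⇒∉ a<π a∈π = ℕ.<-irrefl refl (All.lookup a<π a∈π)

-- The gap above `a` excludes a repetition of `a` and a consecutive pair. The remaining danger is a
-- repeated even part x of `π` with a = x-2 or a = x-3, which the third hypothesis excludes.
𝒞-∷ : 0 ℕ.< a → All (1 + a ℕ.<_) π → (∀ {x} → Even x → mult x π ≡ 2 → 3 + a ℕ.< x) →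
       𝒞 π → 𝒞 (a ∷ π)
𝒞-∷ {a} {π} 0<a 1+a<π far c = record
  { partition     = 0<a ∷ proj₁ partition
                  , linked-∷ (All.map ℕ.<⇒≤ a<π) (proj₂ partition)
  ; noConsecutive = consecutive
  ; oddDistinct   = λ j → single (2 * j + 1) (oddDistinct j)
  ; evenAtMost2   = λ j → single (2 * j) (evenAtMost2 j)
  ; repeatedEven  = λ j eq → isolated j (unrepeated (2 * j) eq)
  }
  where
  open 𝒞 c
  a<π : All (a ℕ.<_) π
  a<π = All.map ℕ.<⇒≤ 1+a<π
  consecutive : ∀ x → ¬ (x ∈ a ∷ π × suc x ∈ a ∷ π)
  consecutive x (here refl , there q)  = below⇒∉ 1+a<π q
  consecutive x (there p   , here refl) = below⇒∉ (All.map (ℕ.≤-trans (s≤s (ℕ.n≤1+n _))) a<π) p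
  consecutive x (there p   , there q)  = noConsecutive x (p , q)
  single : ∀ x {b} → mult x π ℕ.≤ suc b → mult x (a ∷ π) ℕ.≤ suc b
  single x le with a ℕ.≟ x
  ... | yes refl = subst (ℕ._≤ _) (sym (trans (mult-here a π) (cong suc (mult-below a<π)))) (s≤s z≤n)
  ... | no  a≢x  = subst (ℕ._≤ _) (sym (mult-there π a≢x)) le
  unrepeated : ∀ x → mult x (a ∷ π) ≡ 2 → mult x π ≡ 2
  unrepeated x eq with a ℕ.≟ x
  ... | yes refl = ⊥-elim (ℕ.1+n≢0 (ℕ.suc-injective
                     (trans (sym eq) (trans (mult-here a π) (cong suc (mult-below a<π))))))
  ... | no  a≢x  = trans (sym (mult-there π a≢x)) eq
  isolated : ∀ j → mult (2 * j) π ≡ 2 → 2 * j ∸ 3 ∉ a ∷ π × 2 * j ∸ 2 ∉ a ∷ π ×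
                                        2 * j + 2 ∉ a ∷ π × 2 * j + 3 ∉ a ∷ π
  isolated j eq with x , y , z , w ← repeatedEven j eq =
    -- x ≤ 3 + (x ∸ 3) holds for truncated subtraction too, so a = 2j ∸ 3 would give 2j ≤ 3 + a.
    ∉-∷ (λ e → ℕ.<⇒≱ 3+a<2j (subst (λ v → 2 * j ℕ.≤ 3 + v) e (ℕ.m≤n+m∸n (2 * j) 3))) x ,
    ∉-∷ (λ e → ℕ.<⇒≱ (ℕ.<⇒≤ 3+a<2j) (subst (λ v → 2 * j ℕ.≤ 2 + v) e (ℕ.m≤n+m∸n (2 * j) 2))) y ,
    ∉-∷ (λ e → ℕ.<⇒≢ (ℕ.<-≤-trans a<2j (ℕ.m≤m+n (2 * j) 2)) (sym e)) z ,
    ∉-∷ (λ e → ℕ.<⇒≢ (ℕ.<-≤-trans a<2j (ℕ.m≤m+n (2 * j) 3)) (sym e)) w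
    where
    3+a<2j : 3 + a ℕ.< 2 * j
    3+a<2j = far (j , refl) eq
    a<2j : a ℕ.< 2 * j
    a<2j = ℕ.≤-<-trans (ℕ.m≤n+m a 3) 3+a<2j

-- One copy of `a` is added by `𝒞-∷`. The second changes no membership, only the multiplicity of
-- `a`, and the gap of more than 3 isolates the repeated part.
𝒞-∷∷ : Even a → 0 ℕ.< a → All (3 + a ℕ.<_) π → 𝒞 π → 𝒞 (a ∷ a ∷ π)
𝒞-∷∷ {a} {π} even 0<a 3+a<π c = record
  { partition     = 0<a ∷ proj₁ partition
                  , linked-∷ (ℕ.≤-refl ∷ All.map ℕ.<⇒≤ a<π) (proj₂ partition)
  ; noConsecutive = λ x (p , r) → noConsecutive x (dedupe p , dedupe r)
  ; oddDistinct   = λ j → subst (ℕ._≤ 1) (sym (mult-there (a ∷ π) (even≢odd even j))) (oddDistinct j)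
  ; evenAtMost2   = λ j → atMost2 (2 * j) (evenAtMost2 j)
  ; repeatedEven  = λ j → isolated j
  }
  where
  a<π : All (a ℕ.<_) π
  a<π = All.map (ℕ.≤-<-trans (ℕ.m≤n+m a 3)) 3+a<π
  c′ : 𝒞 (a ∷ π)
  c′ = 𝒞-∷ 0<a (All.map (ℕ.≤-<-trans (ℕ.m≤n+m (1 + a) 2)) 3+a<π)
    (λ {x} _ eq → All.lookup 3+a<π (mult>0⇒∈ x π (subst (0 ℕ.<_) (sym eq) (s≤s z≤n)))) c
  open 𝒞 c′
  dedupe : ∀ {x} → x ∈ a ∷ a ∷ π → x ∈ a ∷ π
  dedupe (here refl) = here refl
  dedupe (there p)   = p
  twice : mult a (a ∷ a ∷ π) ≡ 2
  twice = trans (mult-here a (a ∷ π)) (cong suc (trans (mult-here a π) (cong suc (mult-below a<π))))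
  atMost2 : ∀ x → mult x (a ∷ π) ℕ.≤ 2 → mult x (a ∷ a ∷ π) ℕ.≤ 2
  atMost2 x le with a ℕ.≟ x
  ... | yes refl = ℕ.≤-reflexive twice
  ... | no  a≢x  = subst (ℕ._≤ _) (sym (mult-there (a ∷ π) a≢x)) le
  less : ∀ {x} → x ℕ.< a → x ∉ a ∷ a ∷ π
  less x<a (here refl)         = ℕ.<-irrefl refl x<a
  less x<a (there (here refl)) = ℕ.<-irrefl refl x<a
  less x<a (there (there p))   = ℕ.<-asym x<a (All.lookup a<π p)
  between : ∀ {x} → a ℕ.< x → x ℕ.≤ 3 + a → x ∉ a ∷ a ∷ π
  between a<x x≤ (here refl)         = ℕ.<-irrefl refl a<x
  between a<x x≤ (there (here refl)) = ℕ.<-irrefl refl a<x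
  between a<x x≤ (there (there p))   = ℕ.<⇒≱ (All.lookup 3+a<π p) x≤
  ∸-< : ∀ {x} y → 0 ℕ.< x → x ∸ suc y ℕ.< x
  ∸-< {suc x} y _ = s≤s (ℕ.m∸n≤m x y)
  isolated : ∀ j → mult (2 * j) (a ∷ a ∷ π) ≡ 2 →
    2 * j ∸ 3 ∉ a ∷ a ∷ π × 2 * j ∸ 2 ∉ a ∷ a ∷ π × 2 * j + 2 ∉ a ∷ a ∷ π × 2 * j + 3 ∉ a ∷ a ∷ π
  isolated j eq with a ℕ.≟ 2 * j
  ... | yes refl =
    less (∸-< 2 0<a) ,
    less (∸-< 1 0<a) ,
    between (ℕ.m<m+n (2 * j) (s≤s z≤n)) (ℕ.≤-trans (ℕ.≤-reflexive (ℕ.+-comm (2 * j) 2)) (ℕ.n≤1+n _)) ,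
    between (ℕ.m<m+n (2 * j) (s≤s z≤n)) (ℕ.≤-reflexive (ℕ.+-comm (2 * j) 3))
  ... | no a≢2j with x , y , z , w ← repeatedEven j (trans (sym (mult-there (a ∷ π) a≢2j)) eq) =
    (λ p → x (dedupe p)) , (λ p → y (dedupe p)) , (λ p → z (dedupe p)) , (λ p → w (dedupe p))

-- The three classes shifted by s

-- At even s these are 𝒫₁, 𝒫₂ with all parts increased by s, and 𝓡 s consists
-- of the members of 𝓟 s without the part 1 + s.
𝓟 𝓠 𝓡 : ℕ → List ℕ → Set
𝓟 s π = 𝒞 π × All (s ℕ.<_) π × mult (2 + s) π ℕ.≤ 1
𝓡 s π = 𝒞 π × All (1 + s ℕ.<_) π × mult (2 + s) π ℕ.≤ 1
𝓠 s π = 𝒞 π × All (1 + s ℕ.<_) π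

weaken : ∀ k {n} → All (k + n ℕ.<_) π → All (n ℕ.<_) π
weaken k {n} = All.map (ℕ.≤-<-trans (ℕ.m≤n+m n k))

𝓡⇒𝓟 : 𝓡 s π → 𝓟 s π
𝓡⇒𝓟 (c , low , m≤1) = c , weaken 1 low , m≤1

𝓡⇒𝓠 : 𝓡 s π → 𝓠 s π
𝓡⇒𝓠 (c , low , _) = c , low

𝓟⇒𝓡 : 𝓟 (2 + s) π → 𝓡 s π
𝓟⇒𝓡 (c , low , _) = c , weaken 1 low , subst (ℕ._≤ 1) (sym (mult-below low)) z≤n

-- A repeated even part exceeds `s`, differs from `2 + s` by the multiplicity bound, and so is at
-- least `4 + s` by parity.
repeated-bound : Even s → All (s ℕ.<_) π → mult (2 + s) π ℕ.≤ 1 →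
                 ∀ {x} → Even x → mult x π ≡ 2 → 4 + s ℕ.≤ x
repeated-bound {s} {π} even low m≤1 {x} even-x eq =
  even-gap (even-2+ even) even-x (ℕ.≤∧≢⇒<
    (even-gap even even-x (All.lookup low (mult>0⇒∈ x π (subst (0 ℕ.<_) (sym eq) (s≤s z≤n)))))
    λ { refl → ℕ.1+n≰n (subst (ℕ._≤ 1) eq m≤1) })

-- `1 + s` and, in `𝓡-∷`, `2 + s` are the values 2j-3 and 2j-2 for 2j = 4 + s. Hence `4 + s` must
-- not be repeated in the tail, which is the multiplicity bound of the class at `2 + s`.
𝓟-∷ : Even s → 𝓟 (2 + s) π → 𝓟 s (1 + s ∷ π)
𝓟-∷ {s} {π} even (c , low , m≤1) =
  𝒞-∷ (s≤s z≤n) low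
    (λ even-x eq → ℕ.<⇒≤ (repeated-bound (even-2+ even) low m≤1 even-x eq)) c ,
  ℕ.≤-refl ∷ weaken 2 low ,
  subst (ℕ._≤ 1) (sym (trans (mult-there π (ℕ.<⇒≢ ℕ.≤-refl)) (mult-below low))) z≤n

𝓡-∷ : Even s → 𝓡 (2 + s) π → 𝓡 s (2 + s ∷ π)
𝓡-∷ {s} {π} even (c , low , m≤1) =
  𝒞-∷ (s≤s z≤n) low
    (λ even-x eq → repeated-bound (even-2+ even) (weaken 1 low) m≤1 even-x eq) c ,
  ℕ.≤-refl ∷ weaken 2 low ,
  subst (ℕ._≤ 1) (sym (trans (mult-here (2 + s) π) (cong suc (mult-below (weaken 1 low))))) (s≤s z≤n)

𝓠-∷∷ : Even s → 𝓠 (4 + s) π → 𝓠 s (2 + s ∷ 2 + s ∷ π)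
𝓠-∷∷ even (c , low) =
  𝒞-∷∷ (even-2+ even) (s≤s z≤n) low c , ℕ.≤-refl ∷ ℕ.≤-refl ∷ weaken 4 low

𝓡-∷∷ : Even s → 𝓠 (6 + s) π → 𝓡 s (4 + s ∷ 4 + s ∷ π)
𝓡-∷∷ {s} even q with c , low ← 𝓠-∷∷ (even-2+ even) q =
  c , weaken 2 low , subst (ℕ._≤ 1) (sym (mult-below (weaken 1 low))) z≤n

-- Splitting off the smallest parts

raise : All (n ℕ.<_) π → suc n ∉ π → All (suc n ℕ.<_) π
raise {n} {π} n<π n∉π = All.tabulate λ x∈π →
  ℕ.≤∧≢⇒< (All.lookup n<π x∈π) λ { refl → n∉π x∈π }

mult-∷≤⇒∉ : mult a (a ∷ π) ℕ.≤ 1 → a ∉ π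
mult-∷≤⇒∉ {a} {π} m≤1 a∈π =
  ℕ.<⇒≱ (s≤s (∈⇒mult>0 a∈π)) (subst (ℕ._≤ 1) (mult-here a π) m≤1)

mult≡2 : Even a → 𝒞 π → ¬ mult a π ℕ.≤ 1 → mult a π ≡ 2
mult≡2 even c m≰1 = ℕ.≤-antisym (even-mult≤2 even c) (ℕ.≰⇒> m≰1)

-- The part `1 + s` is odd, so it does not repeat, and it excludes its neighbour `2 + s`. It also
-- prevents `4 + s` from being repeated, so the tail is in the class at `2 + s`.
𝓟-view : Even s → 𝓟 s π → (∃[ ρ ] π ≡ 1 + s ∷ ρ × 𝓟 (2 + s) ρ) ⊎ 𝓡 s π
𝓟-view {π = []} even (c , low , m≤1) = inj₂ (c , [] , m≤1)
𝓟-view {s} {a ∷ π} even (c , s<a ∷ low , m≤1) with 1 + s ℕ.≟ a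
... | no  1+s≢a = inj₂ (c , 1+s<a ∷ All.map (ℕ.<-≤-trans 1+s<a) (sorted c) , m≤1)
  where
  1+s<a : 1 + s ℕ.< a
  1+s<a = ℕ.≤∧≢⇒< s<a 1+s≢a
... | yes refl  = inj₁ (π , refl , 𝒞-tail c ,
  raise (raise low (mult-∷≤⇒∉ (odd-mult≤1 even c)))
        (λ 2+s∈π → 𝒞.noConsecutive c (1 + s) (here refl , there 2+s∈π)) ,
  m≤1′)
  where
  m≤1′ : mult (4 + s) π ℕ.≤ 1
  m≤1′ with mult (4 + s) (1 + s ∷ π) ℕ.≤? 1
  ... | yes m≤1 = ℕ.≤-trans (mult-≤-∷ (4 + s) (1 + s) π) m≤1
  ... | no  m≰1 = ⊥-elim (proj₁ (repeated (even-2+ (even-2+ even)) c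
                    (mult≡2 (even-2+ (even-2+ even)) c m≰1)) (here refl))

𝓠-repeated : Even s → 𝓠 s π → mult (2 + s) π ≡ 2 → ∃[ ρ ] π ≡ 2 + s ∷ 2 + s ∷ ρ × 𝓠 (4 + s) ρ
𝓠-repeated {s} {a ∷ π} even (c , 1+s<a ∷ low) eq with 2 + s ℕ.≟ a
... | no  2+s≢a = ⊥-elim (ℕ.0≢1+n (trans (sym (mult-below
        (2+s<a ∷ All.map (ℕ.<-≤-trans 2+s<a) (sorted c)))) eq))
  where
  2+s<a : 2 + s ℕ.< a
  2+s<a = ℕ.≤∧≢⇒< 1+s<a 2+s≢a
𝓠-repeated {s} {.(2 + s) ∷ []} even (c , _ ∷ []) eq | yes refl =
  ⊥-elim (ℕ.0≢1+n (ℕ.suc-injective (trans (sym (mult-here (2 + s) [])) eq)))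
𝓠-repeated {s} {.(2 + s) ∷ b ∷ π} even (c , _ ∷ 1+s<b ∷ low) eq | yes refl with 2 + s ℕ.≟ b
... | no  2+s≢b = ⊥-elim (ℕ.0≢1+n (trans (sym (mult-below
        (2+s<b ∷ All.map (ℕ.<-≤-trans 2+s<b) (sorted (𝒞-tail c)))))
        (ℕ.suc-injective (trans (sym (mult-here (2 + s) (b ∷ π))) eq))))
  where
  2+s<b : 2 + s ℕ.< b
  2+s<b = ℕ.≤∧≢⇒< 1+s<b 2+s≢b
... | yes refl = π , refl , 𝒞-tail (𝒞-tail c) ,
  -- `2 + s`, `3 + s`, `4 + s`, `5 + s` are excluded in this order: by multiplicity, as a
  -- consecutive integer, and the last two as neighbours of a repeated even part.
  raise (raise (raise (raise low
    (λ p → ℕ.<⇒≱ (s≤s (s≤s (∈⇒mult>0 p))) (ℕ.≤-reflexive (trans (sym twice) eq))))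
    (λ p → 𝒞.noConsecutive c (2 + s) (here refl , there (there p))))
    (λ p → proj₁ (proj₂ (proj₂ far)) (there (there p))))
    (λ p → proj₂ (proj₂ (proj₂ far)) (there (there p)))
  where
  twice : mult (2 + s) (2 + s ∷ 2 + s ∷ π) ≡ 2 + mult (2 + s) π
  twice = trans (mult-here (2 + s) (2 + s ∷ π)) (cong suc (mult-here (2 + s) π))
  far = repeated (even-2+ even) c eq

𝓠-view : Even s → 𝓠 s π → (∃[ ρ ] π ≡ 2 + s ∷ 2 + s ∷ ρ × 𝓠 (4 + s) ρ) ⊎ 𝓡 s π
𝓠-view {s} {π} even (c , low) with mult (2 + s) π ℕ.≤? 1
... | yes m≤1 = inj₂ (c , low , m≤1)
... | no  m≰1 = inj₁ (𝓠-repeated even (c , low) (mult≡2 (even-2+ even) c m≰1))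

-- Without `2 + s`, a member of `𝓡 s` belongs to `𝓟 (2 + s)` unless `4 + s` is repeated. In that
-- case `3 + s` is absent too, so the pair stands at the front.
data 𝓡View (s : ℕ) : List ℕ → Set where
  once  : 𝓡 (2 + s) π → 𝓡View s (2 + s ∷ π)
  none  : 𝓟 (2 + s) π → 𝓡View s π
  twice : 𝓠 (6 + s) π → 𝓡View s (4 + s ∷ 4 + s ∷ π)

𝓡-view : Even s → 𝓡 s π → 𝓡View s π
𝓡-view {π = []} even (c , _ , _) = none (c , [] , z≤n)
𝓡-view {s} {a ∷ π} even (c , 1+s<a ∷ low , m≤1) with 2 + s ℕ.≟ a
𝓡-view {s} {a ∷ π} even (c , 1+s<a ∷ low , m≤1) | yes refl = once
  (𝒞-tail c ,
  raise (raise low (mult-∷≤⇒∉ m≤1))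
        (λ 3+s∈π → 𝒞.noConsecutive c (2 + s) (here refl , there 3+s∈π)) ,
  m≤1′)
  where
  m≤1′ : mult (4 + s) π ℕ.≤ 1
  m≤1′ with mult (4 + s) (2 + s ∷ π) ℕ.≤? 1
  ... | yes m≤1 = ℕ.≤-trans (mult-≤-∷ (4 + s) (2 + s) π) m≤1
  ... | no  m≰1 = ⊥-elim (proj₁ (proj₂ (repeated (even-2+ (even-2+ even)) c
                    (mult≡2 (even-2+ (even-2+ even)) c m≰1))) (here refl))
𝓡-view {s} {a ∷ π} even (c , 1+s<a ∷ low , m≤1) | no 2+s≢a = result
  where
  2+s<a : 2 + s ℕ.< a
  2+s<a = ℕ.≤∧≢⇒< 1+s<a 2+s≢a
  low′ : All (2 + s ℕ.<_) (a ∷ π)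
  low′ = 2+s<a ∷ All.map (ℕ.<-≤-trans 2+s<a) (sorted c)
  result : 𝓡View s (a ∷ π)
  result with mult (4 + s) (a ∷ π) ℕ.≤? 1
  ... | yes m≤1 = none (c , low′ , m≤1)
  ... | no  m≰1 with 𝓠-repeated (even-2+ even)
          (c , raise low′ (λ 3+s∈ → 𝒞.noConsecutive c (3 + s)
                 (3+s∈ , mult>0⇒∈ (4 + s) (a ∷ π) (ℕ.<⇒≤ (ℕ.≰⇒> m≰1)))))
          (mult≡2 (even-2+ (even-2+ even)) c m≰1)
  ... | ρ , refl , q = twice q

-- Enumeration

-- The first argument is fuel. The lists contain every member of sum below fuel plus `s`, and
-- possibly some larger ones; at fuel 0 this bound leaves only the empty partition, as all parts
-- exceed `s`.
listP listQ listR : ℕ → ℕ → List (List ℕ)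
listP zero    s = [] ∷ []
listP (suc n) s = map (1 + s ∷_) (listP n (2 + s)) ++ listR (suc n) s
listQ zero    s = [] ∷ []
listQ (suc n) s = map (λ π → 2 + s ∷ 2 + s ∷ π) (listQ n (4 + s)) ++ listR (suc n) s
listR zero    s = [] ∷ []
listR (suc n) s = map (2 + s ∷_) (listR n (2 + s)) ++ (listP n (2 + s) ++
                  map (λ π → 4 + s ∷ 4 + s ∷ π) (listQ n (6 + s)))

soundP : ∀ n → Even s → All (𝓟 s) (listP n s)
soundQ : ∀ n → Even s → All (𝓠 s) (listQ n s)
soundR : ∀ n → Even s → All (𝓡 s) (listR n s)
soundP zero    even = (𝒞-[] , [] , z≤n) ∷ []
soundP (suc n) even = All.++⁺
  (All.map⁺ (All.map (𝓟-∷ even) (soundP n (even-2+ even))))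
  (All.map 𝓡⇒𝓟 (soundR (suc n) even))
soundQ zero    even = (𝒞-[] , []) ∷ []
soundQ (suc n) even = All.++⁺
  (All.map⁺ (All.map (𝓠-∷∷ even) (soundQ n (even-2+ (even-2+ even)))))
  (All.map 𝓡⇒𝓠 (soundR (suc n) even))
soundR zero    even = (𝒞-[] , [] , z≤n) ∷ []
soundR (suc n) even = All.++⁺
  (All.map⁺ (All.map (𝓡-∷ even) (soundR n (even-2+ even))))
  (All.++⁺ (All.map 𝓟⇒𝓡 (soundP n (even-2+ even)))
    (All.map⁺ (All.map (𝓡-∷∷ even) (soundQ n (even-2+ (even-2+ (even-2+ even)))))))

below-sum : sum π ℕ.< s → All (s ℕ.<_) π → π ≡ []
below-sum {[]}    _   _         = refl
below-sum {a ∷ π} lt (s<a ∷ _) = ⊥-elim (ℕ.<-asym s<a (ℕ.≤-<-trans (ℕ.m≤m+n a (sum π)) lt))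

-- A recursive call costs one unit of fuel but raises `s` by `suc k`, so the bound on the sum
-- survives.
bound : ∀ n k {s x} → x ℕ.< suc n + s → x ℕ.< n + (suc k + s)
bound n k {s} {x} lt = ℕ.≤-trans lt
  (ℕ.≤-trans (ℕ.≤-reflexive (sym (ℕ.+-suc n s))) (ℕ.+-monoʳ-≤ n (s≤s (ℕ.m≤n+m s k))))

completeP : ∀ n → Even s → 𝓟 s π → sum π ℕ.< n + s → π ∈ listP n s
completeQ : ∀ n → Even s → 𝓠 s π → sum π ℕ.< n + s → π ∈ listQ n s
completeR : ∀ n → Even s → 𝓡 s π → sum π ℕ.< n + s → π ∈ listR n s
completeR-suc : ∀ n → Even s → 𝓡 s π → sum π ℕ.< suc n + s → π ∈ listR (suc n) s
completeP zero    even (_ , low , _) lt = here (below-sum lt low)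
completeP {s} (suc n) even p lt with 𝓟-view even p
... | inj₁ (ρ , refl , p′) = ∈-++⁺ˡ (∈-map⁺ (1 + s ∷_)
        (completeP n (even-2+ even) p′ (bound n 1 (ℕ.≤-<-trans (ℕ.m≤n+m (sum ρ) (1 + s)) lt))))
... | inj₂ r = ∈-++⁺ʳ (map (1 + s ∷_) (listP n (2 + s))) (completeR-suc n even r lt)
completeQ zero    even (_ , low) lt = here (below-sum lt (weaken 1 low))
completeQ {s} (suc n) even p lt with 𝓠-view even p
... | inj₁ (ρ , refl , q) = ∈-++⁺ˡ (∈-map⁺ (λ π → 2 + s ∷ 2 + s ∷ π)
        (completeQ n (even-2+ (even-2+ even)) q (bound n 3
          (ℕ.≤-<-trans (ℕ.≤-trans (ℕ.m≤n+m (sum ρ) (2 + s)) (ℕ.m≤n+m _ (2 + s))) lt))))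
... | inj₂ r = ∈-++⁺ʳ (map (λ π → 2 + s ∷ 2 + s ∷ π) (listQ n (4 + s)))
        (completeR-suc n even r lt)
completeR zero    even (_ , low , _) lt = here (below-sum lt (weaken 1 low))
completeR (suc n) even r lt = completeR-suc n even r lt
completeR-suc {s} n even p lt with 𝓡-view even p
... | once {ρ} r  = ∈-++⁺ˡ (∈-map⁺ (2 + s ∷_)
        (completeR n (even-2+ even) r (bound n 1 (ℕ.≤-<-trans (ℕ.m≤n+m (sum ρ) (2 + s)) lt))))
... | none p′     = ∈-++⁺ʳ (map (2 + s ∷_) (listR n (2 + s)))
        (∈-++⁺ˡ (completeP n (even-2+ even) p′ (bound n 1 lt)))
... | twice {ρ} q = ∈-++⁺ʳ (map (2 + s ∷_) (listR n (2 + s))) (∈-++⁺ʳ (listP n (2 + s))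
        (∈-map⁺ (λ π → 4 + s ∷ 4 + s ∷ π)
          (completeQ n (even-2+ (even-2+ (even-2+ even))) q (bound n 5
            (ℕ.≤-<-trans (ℕ.≤-trans (ℕ.m≤n+m (sum ρ) (4 + s)) (ℕ.m≤n+m _ (4 + s))) lt)))))

disjoint : {A B : List ℕ → Set} {xs ys : List (List ℕ)} → All A xs → All B ys →
           (∀ {π} → A π → B π → ⊥) → Disjoint xs ys
disjoint axs bys absurd (x∈xs , x∈ys) = absurd (All.lookup axs x∈xs) (All.lookup bys x∈ys)

∷∷-injective : {a : ℕ} {xs ys : List ℕ} → _≡_ {A = List ℕ} (a ∷ a ∷ xs) (a ∷ a ∷ ys) → xs ≡ ys
∷∷-injective refl = refl

mult-∷∷ : ∀ a π → 1 ℕ.< mult a (a ∷ a ∷ π)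
mult-∷∷ a π = subst (1 ℕ.<_)
  (sym (trans (mult-here a (a ∷ π)) (cong suc (mult-here a π)))) (s≤s (s≤s z≤n))

map-all : {A : List ℕ → Set} (f : List ℕ → List ℕ) → (∀ π → A (f π)) → ∀ xs → All A (map f xs)
map-all f af xs = All.map⁺ (All.universal af xs)

-- The pieces of each concatenation are separated by the presence of a smallest part or by whether
-- an even part is repeated.
uniqueP : ∀ n → Even s → Unique (listP n s)
uniqueQ : ∀ n → Even s → Unique (listQ n s)
uniqueR : ∀ n → Even s → Unique (listR n s)
uniqueP zero    even = [] AllPairs.∷ AllPairs.[]
uniqueP {s} (suc n) even = Unique.++⁺
  (Unique.map⁺ List.∷-injectiveʳ (uniqueP n (even-2+ even)))
  (uniqueR (suc n) even)
  (disjoint {A = 1 + s ∈_} (map-all _ (λ _ → here refl) (listP n (2 + s)))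
    (soundR (suc n) even)
    (λ 1+s∈π (_ , low , _) → below⇒∉ low 1+s∈π))
uniqueQ zero    even = [] AllPairs.∷ AllPairs.[]
uniqueQ {s} (suc n) even = Unique.++⁺
  (Unique.map⁺ ∷∷-injective (uniqueQ n (even-2+ (even-2+ even))))
  (uniqueR (suc n) even)
  (disjoint (map-all _ (mult-∷∷ (2 + s)) (listQ n (4 + s)))
    (soundR (suc n) even)
    (λ 1<m (_ , _ , m≤1) → ℕ.<⇒≱ 1<m m≤1))
uniqueR zero    even = [] AllPairs.∷ AllPairs.[]
uniqueR {s} (suc n) even = Unique.++⁺
  (Unique.map⁺ List.∷-injectiveʳ (uniqueR n (even-2+ even)))
  (Unique.++⁺
    (uniqueP n (even-2+ even))
    (Unique.map⁺ ∷∷-injective (uniqueQ n even-6+))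
    (disjoint (soundP n (even-2+ even)) (map-all _ (mult-∷∷ (4 + s)) (listQ n (6 + s)))
      (λ (_ , _ , m≤1) 1<m → ℕ.<⇒≱ 1<m m≤1)))
  (disjoint {A = 2 + s ∈_} {B = All (2 + s ℕ.<_)}
    (map-all _ (λ _ → here refl) (listR n (2 + s)))
    (All.++⁺ (All.map (λ (_ , low , _) → low) (soundP n (even-2+ even)))
      (All.map⁺ (All.map (λ q → weaken 1 (proj₂ (𝓠-∷∷ (even-2+ even) q))) (soundQ n even-6+))))
    (λ 2+s∈π low → below⇒∉ low 2+s∈π))
  where
  even-6+ : Even (6 + s)
  even-6+ = even-2+ (even-2+ (even-2+ even))

-- 𝒫₁, 𝒫₂ and 𝒫₃

even-0 : Even 0
even-0 = 0 , refl

infix⇒repeated : Infix _≡_ (a ∷ a ∷ []) π → 1 ℕ.< mult a π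
infix⇒repeated {a} {_ ∷ _ ∷ π} (here (refl ∷ (refl ∷ _))) = mult-∷∷ a π
infix⇒repeated {a} {b ∷ π} (there inf) = ℕ.≤-trans (infix⇒repeated inf) (mult-≤-∷ a b π)

𝓟⇒𝒫₁ : 𝓟 0 π → 𝒫₁ π
𝓟⇒𝒫₁ (c , _ , m≤1) = c , λ inf → ℕ.<⇒≱ (infix⇒repeated inf) m≤1

-- A repeated 2 excludes the part 1, so both copies stand at the front and form the forbidden
-- sub-partition.
𝒫₁⇒𝓟 : 𝒫₁ π → 𝓟 0 π
𝒫₁⇒𝓟 {π} (c , no22) with mult 2 π ℕ.≤? 1
... | yes m≤1 = c , proj₁ (𝒞.partition c) , m≤1
... | no  m≰1 with 𝓠-repeated even-0
        (c , raise (proj₁ (𝒞.partition c)) (λ 1∈π → 𝒞.noConsecutive c 1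
               (1∈π , mult>0⇒∈ 2 π (ℕ.<⇒≤ (ℕ.≰⇒> m≰1)))))
        (mult≡2 (even-2+ even-0) c m≰1)
... | ρ , refl , _ = ⊥-elim (no22 (here (refl ∷ (refl ∷ []))))

𝓠⇒𝒫₂ : 𝓠 0 π → 𝒫₂ π
𝓠⇒𝒫₂ (c , low) = c , below⇒∉ low

𝒫₂⇒𝓠 : 𝒫₂ π → 𝓠 0 π
𝒫₂⇒𝓠 (c , 1∉π) = c , raise (proj₁ (𝒞.partition c)) 1∉π

𝓠⇒𝒫₃ : 𝓠 2 π → 𝒫₃ π
𝓠⇒𝒫₃ (c , low) = c , below⇒∉ (weaken 2 low) , below⇒∉ (weaken 1 low) , below⇒∉ low

𝒫₃⇒𝓠 : 𝒫₃ π → 𝓠 2 π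
𝒫₃⇒𝓠 (c , 1∉π , 2∉π , 3∉π) =
  c , raise (raise (raise (proj₁ (𝒞.partition c)) 1∉π) 2∉π) 3∉π

sumOver : {I : Set} → List I → (I → ℤ) → ℤ
sumOver is f = foldr ℤ._+_ 0ℤ (map f is)

sumOver-++ : {I : Set} (f : I → ℤ) (is js : List I) →
             sumOver (is ++ js) f ≡ sumOver is f ℤ.+ sumOver js f
sumOver-++ f []       js = sym (ℤ.+-identityˡ _)
sumOver-++ f (i ∷ is) js = trans (cong (ℤ._+_ (f i)) (sumOver-++ f is js))
  (sym (ℤ.+-assoc (f i) (sumOver is f) (sumOver js f)))

sumOver-map : {I J : Set} (h : J → I) (f : I → ℤ) (js : List J) →
              sumOver (map h js) f ≡ sumOver js (f ∘ h)
sumOver-map h f js = cong (foldr ℤ._+_ 0ℤ) (sym (List.map-∘ js))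

-- Generating functions of the enumerations

gf : List (List ℕ) → ℤ⟦x,q⟧
gf πs m n = sumOver πs (λ π → weight π m n)

weight-term : ∀ π m n → weight π m n ≡ term (length π) (sum π) 1ℤ 𝟙 m n
weight-term π m n = cong (if ⌊ m ℕ.≟ length π ⌋ then_else 0ℤ)
  (sym (trans (ℤ.*-identityˡ _) (⊛-identityʳ (q^ (sum π)) n)))

weight-∷ : ∀ a π m n → weight (a ∷ π) m n ≡ shift 1 a (weight π) m n
weight-∷ a π m n = begin
  weight (a ∷ π) m n
    ≡⟨ weight-term (a ∷ π) m n ⟩
  term (1 + length π) (a + sum π) 1ℤ 𝟙 m n
    ≡⟨ shift-term 1 a (length π) (sum π) 1ℤ 𝟙 m n ⟨
  shift 1 a (term (length π) (sum π) 1ℤ 𝟙) m n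
    ≡⟨ shift-cong 1 a m n (λ m n _ _ → sym (weight-term π m n)) ⟩
  shift 1 a (weight π) m n ∎

weight-∷∷ : ∀ a π m n → weight (a ∷ a ∷ π) m n ≡ shift 2 (2 * a) (weight π) m n
weight-∷∷ a π m n = begin
  weight (a ∷ a ∷ π) m n
    ≡⟨ weight-∷ a (a ∷ π) m n ⟩
  shift 1 a (weight (a ∷ π)) m n
    ≡⟨ shift-cong 1 a m n (λ m n _ _ → weight-∷ a π m n) ⟩
  shift 1 a (shift 1 a (weight π)) m n
    ≡⟨ shift-shift 1 a 1 a (weight π) m n ⟩
  shift 2 (a + a) (weight π) m n
    ≡⟨ cong (λ e → shift 2 (a + e) (weight π) m n) (ℕ.+-identityʳ a) ⟨
  shift 2 (2 * a) (weight π) m n ∎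

gf-map : ∀ (h : List ℕ → List ℕ) r a →
         (∀ π m n → weight (h π) m n ≡ shift r a (weight π) m n) →
         ∀ πs m n → gf (map h πs) m n ≡ shift r a (gf πs) m n
gf-map h r a weight-h []       m n = sym (shift-zero r a m n)
gf-map h r a weight-h (π ∷ πs) m n = begin
  weight (h π) m n ℤ.+ gf (map h πs) m n
    ≡⟨ cong₂ ℤ._+_ (weight-h π m n) (gf-map h r a weight-h πs m n) ⟩
  shift r a (weight π) m n ℤ.+ shift r a (gf πs) m n
    ≡⟨ shift-+ r a (weight π) (gf πs) m n ⟨
  shift r a (gf (π ∷ πs)) m n ∎

gf-++ : ∀ πs ρs m n → gf (πs ++ ρs) m n ≡ gf πs m n ℤ.+ gf ρs m n
gf-++ πs ρs m n = sumOver-++ (λ π → weight π m n) πs ρs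

exponent-≥ : ∀ s a b c i j k → s ℕ.≤ a → s ℕ.≤ b → s ℕ.≤ c → degree i j k ≢ 0 →
             s ℕ.≤ exponent a b c i j k
exponent-≥ s a b c (suc i) j k s≤a s≤b s≤c _ =
  ℕ.≤-trans s≤a (ℕ.≤-trans (ℕ.m≤m*n a (suc i)) (ℕ.≤-trans (ℕ.m≤m+n _ (b * j))
    (ℕ.≤-trans (ℕ.m≤m+n _ (3 * k ^ 2)) (ℕ.m≤m+n _ (c * k)))))
exponent-≥ s a b c zero (suc j) k s≤a s≤b s≤c _ =
  ℕ.≤-trans s≤b (ℕ.≤-trans (ℕ.m≤m*n b (suc j)) (ℕ.≤-trans (ℕ.m≤n+m _ (a * 0))
    (ℕ.≤-trans (ℕ.m≤m+n _ (3 * k ^ 2)) (ℕ.m≤m+n _ (c * k)))))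
exponent-≥ s a b c zero zero (suc k) s≤a s≤b s≤c _ =
  ℕ.≤-trans s≤c (ℕ.≤-trans (ℕ.m≤m*n c (suc k)) (ℕ.m≤n+m _ (a * 0 + b * 0 + 3 * suc k ^ 2)))
exponent-≥ s a b c zero zero zero s≤a s≤b s≤c N≢0 = ⊥-elim (N≢0 refl)

-- The base case at fuel 0. Every term with N > 0 has q-exponent at least `s`, so below q^s only the
-- constant term 1 is visible, the weight of the empty partition.
S-low : ∀ s a b c → s ℕ.≤ a → s ℕ.≤ b → s ℕ.≤ c → ∀ m n → n ℕ.< s →
        gf ([] ∷ []) m n ≡ S a b c m n
S-low s a b c s≤a s≤b s≤c zero n n<s = sym (begin
  summands a b c 0 0 0 0 n ℤ.+ 0ℤ ℤ.+ 0ℤ ℤ.+ 0ℤ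
    ≡⟨ trans (ℤ.+-identityʳ _) (ℤ.+-identityʳ _) ⟩
  summands a b c 0 0 0 0 n ℤ.+ 0ℤ
    ≡⟨ cong (ℤ._+ 0ℤ) (begin
      summands a b c 0 0 0 0 n
        ≡⟨ ℤ.*-identityˡ ((q^ (exponent a b c 0 0 0) ⊛ (1/ denominator 0 0 0)) n) ⟩
      (q^ (exponent a b c 0 0 0) ⊛ (1/ denominator 0 0 0)) n
        ≡⟨ ⊛-cong (λ l → cong (λ e → q^ e l) exponent≡0) 1/denominator-0 n ⟩
      (𝟙 ⊛ 𝟙) n
        ≡⟨ ⊛-identityˡ 𝟙 n ⟩
      𝟙 n ∎) ⟩
  𝟙 n ℤ.+ 0ℤ ∎)
  where
  exponent≡0 : exponent a b c 0 0 0 ≡ 0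
  exponent≡0 = cong₂ _+_ (cong (_+ 0) (cong₂ _+_ (ℕ.*-zeroʳ a) (ℕ.*-zeroʳ b))) (ℕ.*-zeroʳ c)
S-low s a b c s≤a s≤b s≤c (suc m) n n<s =
  sym (sum³-zero (2 + m) (2 + m) (2 + m) (summands a b c) (suc m) n vanishes)
  where
  vanishes : ∀ i j k → summands a b c i j k (suc m) n ≡ 0ℤ
  vanishes i j k with suc m ℕ.≟ degree i j k
  ... | no  _  = refl
  ... | yes N≡ = trans
    (cong (ℤ._*_ (-1ℤ ℤ.^ k)) (⊛-q^-vanishes
      (degree i j k * (degree i j k ∸ 1) + exponent a b c i j k) (1/ denominator i j k) n
      (ℕ.<-≤-trans n<s (ℕ.≤-trans (exponent-≥ s a b c i j k s≤a s≤b s≤c (λ N≡0 → ℕ.1+n≢0 (trans N≡ N≡0)))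
        (ℕ.m≤n+m _ (degree i j k * (degree i j k ∸ 1)))))))
    (ℤ.*-zeroʳ (-1ℤ ℤ.^ k))

-- P, Q and R of the overview with xq^s for x.
SP SQ SR : ℕ → ℤ⟦x,q⟧
SP s = S (1 + s) (6 + 2 * s) (6 + 3 * s)
SQ s = S (2 + s) (2 + 2 * s) (6 + 3 * s)
SR s = S (2 + s) (6 + 2 * s) (6 + 3 * s)

S-cong : ∀ {a b b′ c c′} → b ≡ b′ → c ≡ c′ → ∀ m n → S a b c m n ≡ S a b′ c′ m n
S-cong refl refl m n = refl

2*+ : ∀ r s → 2 * (r + s) ≡ 2 * r + 2 * s
2*+ = ℕ.*-distribˡ-+ 2

3*+ : ∀ r s → 3 * (r + s) ≡ 3 * r + 3 * s
3*+ = ℕ.*-distribˡ-+ 3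

-- By induction on the fuel: the lists are built by the recursions that `S-i`, `S-j` and `S-R` give
-- for the series.
gfP : ∀ f s m n → n ℕ.< f + s → gf (listP f s) m n ≡ SP s m n
gfQ : ∀ f s m n → n ℕ.< f + s → gf (listQ f s) m n ≡ SQ s m n
gfR : ∀ f s m n → n ℕ.< f + s → gf (listR f s) m n ≡ SR s m n
gfR-suc : ∀ f s m n → n ℕ.< suc f + s → gf (listR (suc f) s) m n ≡ SR s m n

-- Multiplication by q^a only lowers the coefficient to be compared; the growth of `s` pays for the
-- unit of fuel.
gf-shift : ∀ {V} πs f s r a k m n → n ℕ.< suc f + s →
           (∀ m′ n′ → n′ ℕ.< f + (suc k + s) → gf πs m′ n′ ≡ V m′ n′) →
           shift r a (gf πs) m n ≡ shift r a V m n
gf-shift πs f s r a k m n n< ih = shift-cong r a m n (λ m′ n′ _ n≡ →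
  ih m′ n′ (bound f k (ℕ.≤-<-trans (subst (n′ ℕ.≤_) (sym n≡) (ℕ.m≤n+m n′ a)) n<)))

s≤k*s : ∀ k s → s ℕ.≤ suc k * s
s≤k*s k s = ℕ.m≤m+n s (k * s)

gfP zero    s m n n<s = S-low s (1 + s) (6 + 2 * s) (6 + 3 * s) (ℕ.m≤n+m s 1)
  (ℕ.≤-trans (s≤k*s 1 s) (ℕ.m≤n+m _ 6)) (ℕ.≤-trans (s≤k*s 2 s) (ℕ.m≤n+m _ 6)) m n n<s
gfP (suc f) s m n n< = begin
  gf (map (1 + s ∷_) (listP f (2 + s)) ++ listR (suc f) s) m n
    ≡⟨ gf-++ (map (1 + s ∷_) (listP f (2 + s))) (listR (suc f) s) m n ⟩
  gf (map (1 + s ∷_) (listP f (2 + s))) m n ℤ.+ gf (listR (suc f) s) m n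
    ≡⟨ cong₂ ℤ._+_
         (trans (gf-map (1 + s ∷_) 1 (1 + s) (weight-∷ (1 + s)) (listP f (2 + s)) m n)
           (gf-shift (listP f (2 + s)) f s 1 (1 + s) 1 m n n< λ m′ n′ n′< →
             trans (gfP f (2 + s) m′ n′ n′<)
               (S-cong {3 + s} (cong (6 +_) (2*+ 2 s)) (cong (6 +_) (3*+ 2 s)) m′ n′)))
         (gfR-suc f s m n n<) ⟩
  shift 1 (1 + s) (S (3 + s) (10 + 2 * s) (12 + 3 * s)) m n ℤ.+ SR s m n
    ≡⟨ ℤ.+-comm (shift 1 (1 + s) (S (3 + s) (10 + 2 * s) (12 + 3 * s)) m n) (SR s m n) ⟩
  SR s m n ℤ.+ shift 1 (1 + s) (S (3 + s) (10 + 2 * s) (12 + 3 * s)) m n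
    ≡⟨ S-i (1 + s) (6 + 2 * s) (6 + 3 * s) m n ⟨
  SP s m n ∎

gfQ zero    s m n n<s = S-low s (2 + s) (2 + 2 * s) (6 + 3 * s) (ℕ.m≤n+m s 2)
  (ℕ.≤-trans (s≤k*s 1 s) (ℕ.m≤n+m _ 2)) (ℕ.≤-trans (s≤k*s 2 s) (ℕ.m≤n+m _ 6)) m n n<s
gfQ (suc f) s m n n< = begin
  gf (map (λ π → 2 + s ∷ 2 + s ∷ π) (listQ f (4 + s)) ++ listR (suc f) s) m n
    ≡⟨ gf-++ (map (λ π → 2 + s ∷ 2 + s ∷ π) (listQ f (4 + s))) (listR (suc f) s) m n ⟩
  gf (map (λ π → 2 + s ∷ 2 + s ∷ π) (listQ f (4 + s))) m n ℤ.+ gf (listR (suc f) s) m n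
    ≡⟨ cong₂ ℤ._+_
         (trans (gf-map (λ π → 2 + s ∷ 2 + s ∷ π) 2 (2 * (2 + s)) (weight-∷∷ (2 + s))
             (listQ f (4 + s)) m n)
           (trans (gf-shift (listQ f (4 + s)) f s 2 (2 * (2 + s)) 3 m n n< λ m′ n′ n′< →
             trans (gfQ f (4 + s) m′ n′ n′<)
               (S-cong {6 + s} (cong (2 +_) (2*+ 4 s)) (cong (6 +_) (3*+ 4 s)) m′ n′))
             (cong (λ a → shift 2 a (S (6 + s) (10 + 2 * s) (18 + 3 * s)) m n) (2*+ 2 s))))
         (gfR-suc f s m n n<) ⟩
  shift 2 (4 + 2 * s) (S (6 + s) (10 + 2 * s) (18 + 3 * s)) m n ℤ.+ SR s m n
    ≡⟨ ℤ.+-comm (shift 2 (4 + 2 * s) (S (6 + s) (10 + 2 * s) (18 + 3 * s)) m n) (SR s m n) ⟩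
  SR s m n ℤ.+ shift 2 (4 + 2 * s) (S (6 + s) (10 + 2 * s) (18 + 3 * s)) m n
    ≡⟨ S-j (2 + s) (2 + 2 * s) (6 + 3 * s) m n ⟨
  SQ s m n ∎

gfR zero    s m n n<s = S-low s (2 + s) (6 + 2 * s) (6 + 3 * s) (ℕ.m≤n+m s 2)
  (ℕ.≤-trans (s≤k*s 1 s) (ℕ.m≤n+m _ 6)) (ℕ.≤-trans (s≤k*s 2 s) (ℕ.m≤n+m _ 6)) m n n<s
gfR (suc f) s m n n< = gfR-suc f s m n n<

gfR-suc f s m n n< = begin
  gf (L₁ ++ (L₂ ++ L₃)) m n
    ≡⟨ trans (gf-++ L₁ (L₂ ++ L₃) m n) (cong (ℤ._+_ (gf L₁ m n)) (gf-++ L₂ L₃ m n)) ⟩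
  gf L₁ m n ℤ.+ (gf L₂ m n ℤ.+ gf L₃ m n)
    ≡⟨ cong₂ ℤ._+_
      (trans (gf-map (2 + s ∷_) 1 (2 + s) (weight-∷ (2 + s)) (listR f (2 + s)) m n)
        (gf-shift (listR f (2 + s)) f s 1 (2 + s) 1 m n n< λ m′ n′ n′< →
          trans (gfR f (2 + s) m′ n′ n′<)
            (S-cong {4 + s} (cong (6 +_) (2*+ 2 s)) (cong (6 +_) (3*+ 2 s)) m′ n′)))
      (cong₂ ℤ._+_
        (trans (gfP f (2 + s) m n (bound f 1 n<))
          (S-cong {3 + s} (cong (6 +_) (2*+ 2 s)) (cong (6 +_) (3*+ 2 s)) m n))
        (trans (gf-map (λ π → 4 + s ∷ 4 + s ∷ π) 2 (2 * (4 + s)) (weight-∷∷ (4 + s))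
            (listQ f (6 + s)) m n)
          (trans (gf-shift (listQ f (6 + s)) f s 2 (2 * (4 + s)) 5 m n n< λ m′ n′ n′< →
            trans (gfQ f (6 + s) m′ n′ n′<)
              (S-cong {8 + s} (cong (2 +_) (2*+ 6 s)) (cong (6 +_) (3*+ 6 s)) m′ n′))
            (cong (λ a → shift 2 a (S (8 + s) (14 + 2 * s) (24 + 3 * s)) m n) (2*+ 4 s))))) ⟩
  shift 1 (2 + s) (S (4 + s) (10 + 2 * s) (12 + 3 * s)) m n ℤ.+
  (S (3 + s) (10 + 2 * s) (12 + 3 * s) m n ℤ.+
   shift 2 (8 + 2 * s) (S (8 + s) (14 + 2 * s) (24 + 3 * s)) m n)
    ≡⟨ S-R s (2 * s) (3 * s) refl m n ⟨
  SR s m n ∎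
  where
  L₁ = map (2 + s ∷_) (listR f (2 + s))
  L₂ = listP f (2 + s)
  L₃ = map (λ π → 4 + s ∷ 4 + s ∷ π) (listQ f (6 + s))

-- Formal sums

sumOver-applyUpTo : ∀ {I : Set} (g : ℕ → I) (f : I → ℤ) n →
                    sumOver (applyUpTo g n) f ≡ sum< n (f ∘ g)
sumOver-applyUpTo g f zero    = refl
sumOver-applyUpTo g f (suc n) = cong (ℤ._+_ (f (g 0))) (sumOver-applyUpTo (g ∘ suc) f n)

sumOver-cartesianProduct : {I J : Set} (f : I × J → ℤ) (is : List I) (js : List J) →
  sumOver (cartesianProduct is js) f ≡ sumOver is (λ i → sumOver js (λ j → f (i , j)))
sumOver-cartesianProduct f []       js = refl
sumOver-cartesianProduct f (i ∷ is) js = trans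
  (sumOver-++ f (map (i ,_) js) (cartesianProduct is js))
  (cong₂ ℤ._+_ (sumOver-map (i ,_) f js) (sumOver-cartesianProduct f is js))

box : ℕ → List (ℕ × ℕ × ℕ)
box n = cartesianProduct (upTo n) (cartesianProduct (upTo n) (upTo n))

sumOver-box : ∀ n (f : ℕ × ℕ × ℕ → ℤ) →
  sumOver (box n) f ≡ sum< n (λ i → sum< n (λ j → sum< n (λ k → f (i , j , k))))
sumOver-box n f = begin
  sumOver (box n) f
    ≡⟨ sumOver-cartesianProduct f (upTo n) (cartesianProduct (upTo n) (upTo n)) ⟩
  sumOver (upTo n) (λ i → sumOver (cartesianProduct (upTo n) (upTo n)) (λ jk → f (i , jk)))
    ≡⟨ sumOver-applyUpTo (λ i → i) _ n ⟩
  sum< n (λ i → sumOver (cartesianProduct (upTo n) (upTo n)) (λ jk → f (i , jk)))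
    ≡⟨ sum<-cong n (λ i → begin
      sumOver (cartesianProduct (upTo n) (upTo n)) (λ jk → f (i , jk))
        ≡⟨ sumOver-cartesianProduct (λ jk → f (i , jk)) (upTo n) (upTo n) ⟩
      sumOver (upTo n) (λ j → sumOver (upTo n) (λ k → f (i , j , k)))
        ≡⟨ sumOver-applyUpTo (λ j → j) _ n ⟩
      sum< n (λ j → sumOver (upTo n) (λ k → f (i , j , k)))
        ≡⟨ sum<-cong n (λ j → sumOver-applyUpTo (λ k → k) (λ k → f (i , j , k)) n) ⟩
      sum< n (λ j → sum< n (λ k → f (i , j , k))) ∎) ⟩
  sum< n (λ i → sum< n (λ j → sum< n (λ k → f (i , j , k)))) ∎

hasSum-total : ∀ e → HasSum U (summand e) (total (λ i j k → summand e (i , j , k)))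
hasSum-total e m n =
  box (suc m) ,
  Unique.cartesianProduct⁺ (Unique.upTo⁺ (suc m))
    (Unique.cartesianProduct⁺ (Unique.upTo⁺ (suc m)) (Unique.upTo⁺ (suc m))) ,
  All.universal (λ _ → tt) (box (suc m)) ,
  (λ (i , j , k) _ ∉box → summand-graded e i j k m n λ { refl → ∉box
    (∈-cartesianProduct⁺ (∈-upTo⁺ (s≤s (i≤degree i j k)))
      (∈-cartesianProduct⁺ (∈-upTo⁺ (s≤s (j≤degree i j k))) (∈-upTo⁺ (s≤s (k≤degree i j k))))) }) ,
  sym (sumOver-box (suc m) (λ ijk → summand e ijk m n))

-- For the coefficient of xᵐqⁿ the list at n+1 suffices: it contains all members of sum n, and
-- members of any other sum contribute 0.
hasSum-list : ∀ {P : List ℕ → Set} {V : ℤ⟦x,q⟧} (list : ℕ → List (List ℕ)) →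
  (∀ n → Unique (list n)) → (∀ n → All P (list n)) →
  (∀ {π} → P π → π ∈ list (suc (sum π))) →
  (∀ m n → gf (list (suc n)) m n ≡ V m n) →
  HasSum P weight V
hasSum-list list unique sound complete gf≗V m n =
  list (suc n) , unique (suc n) , sound (suc n) , vanishes , sym (gf≗V m n)
  where
  vanishes : ∀ π → _ → π ∉ list (suc n) → weight π m n ≡ 0ℤ
  vanishes π p π∉ with ⌊ m ℕ.≟ ℓ π ⌋ | n ℕ.≟ sum π
  ... | false | _        = refl
  ... | true  | no _     = refl
  ... | true  | yes refl = ⊥-elim (π∉ (complete p))

hasSum-𝒫₁ : HasSum 𝒫₁ weight (S 1 6 6)
hasSum-𝒫₁ = hasSum-list (λ n → listP n 0)
  (λ n → uniqueP n even-0) (λ n → All.map 𝓟⇒𝒫₁ (soundP n even-0))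
  (λ {π} p → completeP (suc (sum π)) even-0 (𝒫₁⇒𝓟 p) (ℕ.m≤m+n _ 0))
  (λ m n → gfP (suc n) 0 m n (ℕ.m≤m+n _ 0))

hasSum-𝒫₂ : HasSum 𝒫₂ weight (S 2 2 6)
hasSum-𝒫₂ = hasSum-list (λ n → listQ n 0)
  (λ n → uniqueQ n even-0) (λ n → All.map 𝓠⇒𝒫₂ (soundQ n even-0))
  (λ {π} p → completeQ (suc (sum π)) even-0 (𝒫₂⇒𝓠 p) (ℕ.m≤m+n _ 0))
  (λ m n → gfQ (suc n) 0 m n (ℕ.m≤m+n _ 0))

-- `𝒫₃` amounts to `𝓠 2`, and `SQ 2` computes to `S 4 6 12`.
hasSum-𝒫₃ : HasSum 𝒫₃ weight (S 4 6 12)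
hasSum-𝒫₃ = hasSum-list (λ n → listQ n 2)
  (λ n → uniqueQ n (even-2+ even-0)) (λ n → All.map 𝓠⇒𝒫₃ (soundQ n (even-2+ even-0)))
  (λ {π} p → completeQ (suc (sum π)) (even-2+ even-0) (𝒫₃⇒𝓠 p) (ℕ.m≤m+n _ 2))
  (λ m n → gfQ (suc n) 2 m n (ℕ.m≤m+n _ 2))

HasSum-cong : {I : Set} {P : I → Set} {F G : I → ℤ⟦x,q⟧} {V : ℤ⟦x,q⟧} →
              (∀ i m n → F i m n ≡ G i m n) → HasSum P F V → HasSum P G V
HasSum-cong F≗G hasSum m n with is , unique , all , rest , eq ← hasSum m n =
  is , unique , all , (λ i p i∉ → trans (sym (F≗G i m n)) (rest i p i∉)) ,
  trans eq (cong (foldr ℤ._+_ 0ℤ) (List.map-cong (λ i → F≗G i m n) is))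

mainTheorem1 :
    SameSum 𝒫₁ weight U (summand (λ i j k → i + 6 * j + 3 * k ^ 2 + 6 * k)) ×
    SameSum 𝒫₂ weight U (summand (λ i j k → 2 * i + 2 * j + 3 * k ^ 2 + 6 * k)) ×
    SameSum 𝒫₃ weight U (summand (λ i j k → 4 * i + 6 * j + 3 * k ^ 2 + 12 * k))
mainTheorem1 =
  (S 1 6 6 , hasSum-𝒫₁ , HasSum-cong
    -- `exponent 1 6 6` has `1 * i` in place of `i`; the other two exponents match by computation.
    (λ (i , j , k) m n → cong
      (λ z → summand (λ _ _ _ → z + 6 * j + 3 * k ^ 2 + 6 * k) (i , j , k) m n) (ℕ.*-identityˡ i))
    (hasSum-total (exponent 1 6 6))) ,
  (S 2 2 6 , hasSum-𝒫₂ , hasSum-total (exponent 2 2 6)) ,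
  (S 4 6 12 , hasSum-𝒫₃ , hasSum-total (exponent 4 6 12))
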